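{- Let $n\ge 1$. As maps from $\mathcal{S}_n(132)$ to $\mathcal{D}_n$, $$\kappa=\psi\circ\Phi\circ\rho,$$ where $\kappa:\mathcal{S}_n(132)\to\mathcal{D}_n$ is Krattenthaler's bijection, $\Phi:\mathcal{S}_n(231)\to\mathcal{D}_n$, $\rho$ is the reversal of permutations, and $\psi:\mathcal{D}_n\to\mathcal{D}_n$ is the map on Dyck paths, all as defined in the context.
   Context: $\mathcal{S}_n$ is the symmetric group on $[n]=\{1,\dots,n\}$. $\mathcal{S}_n(132)$ is the set of $\sigma\in\mathcal{S}_n$ with no $i<j<k$ satisfying $\sigma_i<\sigma_k<\sigma_j$; $\mathcal{S}_n(231)$ is the set of $\sigma\in\mathcal{S}_n$ with no $i<j<k$ satisfying $\sigma_k<\sigma_i<\sigma_j$. $\rho([\sigma_1,\dots,\sigma_n])=[\sigma_n,\dots,\sigma_1]$, which maps $\mathcal{S}_n(132)$ onto $\mathcal{S}_n(231)$. $\operatorname{Des}(\sigma)=\{i : 1\le i<n,\ \sigma_i>\sigma_{i+1}\}$ and $\operatorname{iDes}(\sigma)=\operatorname{Des}(\sigma^{ -1})$. A Dyck path of semilength $n$ is a word $D=D_1\cdots D_{2n}$ with $n$ letters $0$ (north steps) and $n$ letters $1$ (east steps) such that every prefix contains at least as many $0$'s as $1$'s; $\mathcal{D}_n$ is the set of these. A valley of $D$ is an $i$ with $D_i=1$, $D_{i+1}=0$; its coordinates are $(x,y)$ with $x$ the number of $1$'s and $y$ the number of $0$'s among $D_1,\dots,D_i$. $\operatorname{Set}_X(D)$,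 $\operatorname{Set}_Y(D)$ are the sets of $x$- and $y$-coordinates of the valleys of $D$; $D$ is uniquely determined by these two sets. The height of $D$ at position $i$ is the number of $0$'s minus the number of $1$'s among $D_1,\dots,D_i$. $\Phi$: for $\sigma\in\mathcal{S}_n(231)$ the sets $\operatorname{Des}(\sigma)=\{i_1<\dots<i_k\}$ and $\operatorname{iDes}(\sigma)=\{i'_1<\dots<i'_k\}$ have the same cardinality; with $i_{k+1}=i'_{k+1}=n$, $\Phi(\sigma)$ is the Dyck path consisting of $i'_1$ $0$'s, then $i_1$ $1$'s, then $i'_2-i'_1$ $0$'s, then $i_2-i_1$ $1$'s, and so on, ending with $i'_{k+1}-i'_k$ $0$'s and $i_{k+1}-i_k$ $1$'s (for $k=0$ it is $0^n1^n$). $\kappa$: for $\sigma\in\mathcal{S}_n(132)$ let $h_i$ be the number of $j>i$ with $\sigma_j>\sigma_i$. Read $\sigma$ from left to right and successively generate a Dyck path: when $\sigma_i$ is read, adjoin as many north steps as necessary, followed by an east step from height $h_i+1$ to height $h_i$. The resulting path is $\kappa(\sigma)$. $\psi$: let $\Psi:\mathcal{D}_n\to\mathcal{D}_n$ be the involution sending $D$ to the unique Dyck path $D'$ with $\operatorname{Set}_X(D')=[n-1]\setminus\operatorname{Set}_Y(D)$ and $\operatorname{Set}_Y(D')=[n-1]\setminus\operatorname{Set}_X(D)$. Then $\psi$ is $\Psi$ followed by the involution sending a Dyck path with valleys $\{(i_1,j_1),\dots,(i_k,j_k)\}$ to the Dyck path with valleys $\{(n-j_k,n-i_k),\dots,(n-j_1,n-i_1)\}$.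 -}

module Defs where

open import Data.Empty using (⊥; ⊥-elim)
open import Data.Nat using (ℕ; zero; suc; _+_; _∸_; _⊓_; _≤_; _<_; z≤n; s≤s; z<s; s<s)
import Data.Nat as ℕ
import Data.Nat.Properties as ℕₚ
open import Data.Fin using (Fin; zero; suc; toℕ; fromℕ; fromℕ<; inject; inject₁; opposite; Fin′)
import Data.Fin as Fin
import Data.Fin.Properties as Finₚ
open import Data.Fin.Permutation using (Permutation′; _⟨$⟩ʳ_; _⟨$⟩ˡ_; inverseˡ; inverseʳ; flip; reverse; _∘ₚ_)
open import Data.List using (List; []; _∷_; [_]; _++_; _∷ʳ_; length; map; filter; replicate; take; zip; applyUpTo; tabulate; allFin)
import Data.List as List
import Data.List.Properties as Listₚ
open import Data.List.Membership.Propositional using (_∈_; _∉_)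
import Data.List.Membership.Propositional.Properties as ∈ₚ
open import Data.List.Membership.DecPropositional ℕₚ._≟_ using (_∈?_)
open import Data.List.Relation.Unary.All as All using (All; []; _∷_)
import Data.List.Relation.Unary.All.Properties as Allₚ
open import Data.List.Relation.Unary.Any using (here; there)
open import Data.List.Relation.Unary.AllPairs as AllPairs using (AllPairs; []; _∷_)
import Data.List.Relation.Unary.AllPairs.Properties as AllPairsₚ
open import Data.List.Relation.Unary.Unique.Propositional using (Unique)
import Data.List.Relation.Unary.Unique.Propositional.Properties as Uniqueₚ
open import Data.List.Relation.Binary.Pointwise using (Pointwise; []; _∷_)
open import Data.Product using (Σ; ∃; ∃₂; ∃!; _×_; _,_; proj₁; proj₂)
open import Data.Sum using (_⊎_; inj₁; inj₂)
open import Function using (_∘_; id)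
open import Relation.Binary using (tri<; tri≈; tri>)
open import Relation.Binary.PropositionalEquality
  using (_≡_; _≢_; refl; sym; trans; cong; cong₂; subst; subst₂; module ≡-Reasoning)
open import Relation.Nullary using (¬_; Dec; yes; no; contradiction; ¬?)
open import Relation.Nullary.Decidable using (_×-dec_; map′)
open import Relation.Unary using (Pred; Decidable; ∁; _∖_; _≐_)
open import Relation.Unary.Properties using (∁?)
open import Level using (0ℓ)

-- Permutations.  `Fin n` stands for [n], so the entry σᵢ (1 ≤ i ≤ n) is
-- suc (toℕ (σ ⟨$⟩ʳ j)) for the j with i ≡ suc (toℕ j).

Avoids132 : ∀ {n} → Permutation′ n → Set
Avoids132 {n} σ = ∀ (i j k : Fin n) → i Fin.< j → j Fin.< k →
  ¬ (σ ⟨$⟩ʳ i Fin.< σ ⟨$⟩ʳ k × σ ⟨$⟩ʳ k Fin.< σ ⟨$⟩ʳ j)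

Avoids231 : ∀ {n} → Permutation′ n → Set
Avoids231 {n} σ = ∀ (i j k : Fin n) → i Fin.< j → j Fin.< k →
  ¬ (σ ⟨$⟩ʳ k Fin.< σ ⟨$⟩ʳ i × σ ⟨$⟩ʳ i Fin.< σ ⟨$⟩ʳ j)

S132 : ℕ → Set
S132 n = Σ (Permutation′ n) Avoids132

S231 : ℕ → Set
S231 n = Σ (Permutation′ n) Avoids231

-- j and k are the positions i and i + 1 in the 1-based numbering.
Des : ∀ {n} → Permutation′ n → Pred ℕ 0ℓ
Des {n} σ i = ∃₂ λ (j k : Fin n) →
  i ≡ suc (toℕ j) × toℕ k ≡ suc (toℕ j) × σ ⟨$⟩ʳ k Fin.< σ ⟨$⟩ʳ j

iDes : ∀ {n} → Permutation′ n → Pred ℕ 0ℓ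
iDes σ = Des (flip σ)

Des? : ∀ {n} (σ : Permutation′ n) → Decidable (Des σ)
Des? σ i = Finₚ.any? λ j → Finₚ.any? λ k →
  (i ℕₚ.≟ suc (toℕ j)) ×-dec (toℕ k ℕₚ.≟ suc (toℕ j)) ×-dec
  ((σ ⟨$⟩ʳ k) Finₚ.<? (σ ⟨$⟩ʳ j))

iDes? : ∀ {n} (σ : Permutation′ n) → Decidable (iDes σ)
iDes? σ = Des? (flip σ)

[1⋯_] : ℕ → List ℕ
[1⋯ m ] = applyUpTo suc m

-- The elements i₁ < ⋯ < iₖ of Des σ ⊆ [n-1], in increasing order.
desList : ∀ {n} → Permutation′ n → List ℕ
desList {n} σ = filter (Des? σ) [1⋯ n ∸ 1 ]

iDesList : ∀ {n} → Permutation′ n → List ℕ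
iDesList {n} σ = filter (iDes? σ) [1⋯ n ∸ 1 ]

-- north is the letter 0, east is the letter 1.
data Step : Set where
  north east : Step

#north : List Step → ℕ
#north []          = 0
#north (north ∷ w) = suc (#north w)
#north (east  ∷ w) = #north w

#east : List Step → ℕ
#east []          = 0
#east (north ∷ w) = #east w
#east (east  ∷ w) = suc (#east w)

record Dyck (n : ℕ) : Set where
  constructor dyck
  field
    word   : List Step
    norths : #north word ≡ n
    easts  : #east word ≡ n
    ballot : ∀ i → #east (take i word) ≤ #north (take i word)

open Dyck public

infix 4 _≈_

_≈_ : ∀ {n} → Dyck n → Dyck n → Set
D ≈ D' = word D ≡ word D'

-- The prefix D₁⋯Dᵢ ending at the valley i is u ∷ʳ east.
IsValley : List Step → Pred (ℕ × ℕ) 0ℓ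
IsValley w (x , y) = ∃₂ λ u v →
  w ≡ u ++ east ∷ north ∷ v × x ≡ #east (u ∷ʳ east) × y ≡ #north (u ∷ʳ east)

Valleys : ∀ {n} → Dyck n → Pred (ℕ × ℕ) 0ℓ
Valleys D = IsValley (word D)

SetX : ∀ {n} → Dyck n → Pred ℕ 0ℓ
SetX D x = ∃ λ y → Valleys D (x , y)

SetY : ∀ {n} → Dyck n → Pred ℕ 0ℓ
SetY D y = ∃ λ x → Valleys D (x , y)

-- blocks x y (x₁ ∷ x₂ ∷ …) (y₁ ∷ y₂ ∷ …) consists of y₁ - y norths,
-- x₁ - x easts, y₂ - y₁ norths, x₂ - x₁ easts, ….  For a 231-avoiding
-- permutation the two lists have equal length (see Des-dominates), so no
-- entry is lost.
blocks : ℕ → ℕ → List ℕ → List ℕ → List Step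
blocks x y []        _         = []
blocks x y (_ ∷ _)   []        = []
blocks x y (x' ∷ xs) (y' ∷ ys) =
  replicate (y' ∸ y) north ++ replicate (x' ∸ x) east ++ blocks x' y' xs ys

Φ-word : ∀ {n} → Permutation′ n → List Step
Φ-word {n} σ = blocks 0 0 (desList σ ∷ʳ n) (iDesList σ ∷ʳ n)

larger-right? : ∀ {n} (σ : Permutation′ n) (i : Fin n) →
  Decidable (λ j → i Fin.< j × σ ⟨$⟩ʳ i Fin.< σ ⟨$⟩ʳ j)
larger-right? σ i j = (i Finₚ.<? j) ×-dec ((σ ⟨$⟩ʳ i) Finₚ.<? (σ ⟨$⟩ʳ j))

κ-height : ∀ {n} → Permutation′ n → Fin n → ℕ
κ-height {n} σ i = length (filter (larger-right? σ i) (allFin n))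

-- The first argument is the height reached so far; the list holds the
-- numbers hᵢ still to be read.  For a 132-avoiding permutation c ≤ suc h
-- always holds (see κ-height-step), so ∸ does not truncate.
κ-read : ℕ → List ℕ → List Step
κ-read c []       = []
κ-read c (h ∷ hs) = replicate (suc h ∸ c) north ++ east ∷ κ-read h hs

κ-word : ∀ {n} → Permutation′ n → List Step
κ-word σ = κ-read 0 (tabulate (κ-height σ))

[n-1] : ℕ → Pred ℕ 0ℓ
[n-1] n i = 1 ≤ i × i < n

IsΨ : ∀ {n} → Dyck n → Dyck n → Set
IsΨ {n} D D' = SetX D' ≐ ([n-1] n ∖ SetY D) × SetY D' ≐ ([n-1] n ∖ SetX D)

IsReflection : ∀ {n} → Dyck n → Dyck n → Set
IsReflection {n} D D' =
  Valleys D' ≐ λ (x , y) → ∃₂ λ i j → Valleys D (i , j) × x ≡ n ∸ j × y ≡ n ∸ i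

-- Paths from height c down to height 0 that never go below 0.
Descends : ℕ → List Step → Set
Descends c       []          = c ≡ 0
Descends c       (north ∷ w) = Descends (suc c) w
Descends zero    (east  ∷ w) = ⊥
Descends (suc c) (east  ∷ w) = Descends c w

descends-ballot : ∀ c w → Descends c w → ∀ i → #east (take i w) ≤ c + #north (take i w)
descends-ballot c w d zero = z≤n
descends-ballot c [] d (suc i) = z≤n
descends-ballot c (north ∷ w) d (suc i) =
  subst (#east (take i w) ≤_) (sym (ℕₚ.+-suc c _)) (descends-ballot (suc c) w d i)
descends-ballot (suc c) (east ∷ w) d (suc i) = s≤s (descends-ballot c w d i)

descends-total : ∀ c w → Descends c w → #east w ≡ c + #north w
descends-total c [] d = sym (trans (ℕₚ.+-identityʳ c) d)
descends-total c (north ∷ w) d = trans (descends-total (suc c) w d) (sym (ℕₚ.+-suc c _))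
descends-total (suc c) (east ∷ w) d = cong suc (descends-total c w d)

mkDyck : ∀ {n} w → #north w ≡ n → Descends 0 w → Dyck n
mkDyck w eq d = dyck w eq (trans (descends-total 0 w d) eq) (descends-ballot 0 w d)

ballot-descends : ∀ c w → (∀ i → #east (take i w) ≤ c + #north (take i w)) →
  #east w ≡ c + #north w → Descends c w
ballot-descends c [] b t = sym (trans t (ℕₚ.+-identityʳ c))
ballot-descends c (north ∷ w) b t = ballot-descends (suc c) w
  (λ i → subst (#east (take i w) ≤_) (ℕₚ.+-suc c _) (b (suc i)))
  (trans t (ℕₚ.+-suc c _))
ballot-descends zero (east ∷ w) b t = ℕₚ.n≮0 (b 1)
ballot-descends (suc c) (east ∷ w) b t = ballot-descends c w
  (λ i → ℕₚ.≤-pred (b (suc i))) (ℕₚ.suc-injective t)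

Dyck-descends : ∀ {n} (D : Dyck n) → Descends 0 (word D)
Dyck-descends D = ballot-descends 0 (word D) (ballot D) (trans (easts D) (sym (norths D)))

descends-norths : ∀ k {c w} → Descends (k + c) w → Descends c (replicate k north ++ w)
descends-norths zero d = d
descends-norths (suc k) {c} {w} d =
  descends-norths k (subst (λ m → Descends m w) (sym (ℕₚ.+-suc k c)) d)

descends-easts : ∀ k {c w} → Descends c w → Descends (k + c) (replicate k east ++ w)
descends-easts zero d = d
descends-easts (suc k) d = descends-easts k d

#north-norths : ∀ k w → #north (replicate k north ++ w) ≡ k + #north w
#north-norths zero w = refl
#north-norths (suc k) w = cong suc (#north-norths k w)

#north-easts : ∀ k w → #north (replicate k east ++ w) ≡ #north w
#north-easts zero w = refl
#north-easts (suc k) w = #north-easts k w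

#north-++ : ∀ u v → #north (u ++ v) ≡ #north u + #north v
#north-++ [] v = refl
#north-++ (north ∷ u) v = cong suc (#north-++ u v)
#north-++ (east ∷ u) v = #north-++ u v

#east-++ : ∀ u v → #east (u ++ v) ≡ #east u + #east v
#east-++ [] v = refl
#east-++ (north ∷ u) v = #east-++ u v
#east-++ (east ∷ u) v = cong suc (#east-++ u v)

-- Lists of valley coordinates: Chain n a b xs ys says that
-- (a , b), (x₁ , y₁), …, (n , n) increase strictly in both coordinates
-- and stay weakly above the diagonal.
data Chain (n : ℕ) : ℕ → ℕ → List ℕ → List ℕ → Set where
  end  : ∀ {a b} → a < n → b < n → Chain n a b [] []
  step : ∀ {a b x y xs ys} → a < x → b < y → x ≤ y →
    Chain n x y xs ys → Chain n a b (x ∷ xs) (y ∷ ys)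

mkChain : ∀ {n a b xs ys} → a < n → b < n → Pointwise _≤_ xs ys →
  All (a <_) xs → All (b <_) ys → AllPairs _<_ xs → AllPairs _<_ ys →
  All (_< n) xs → All (_< n) ys → Chain n a b xs ys
mkChain a<n b<n [] _ _ _ _ _ _ = end a<n b<n
mkChain a<n b<n (x≤y ∷ p) (ax ∷ _) (by ∷ _) (sx ∷ sxs) (sy ∷ sys) (x<n ∷ nxs) (y<n ∷ nys) =
  step ax by x≤y (mkChain x<n y<n p sx sy sxs sys nxs nys)

block-descends : ∀ {a b c x y} w → a + c ≡ b → a ≤ x → b ≤ y → x ≤ y →
  Descends (y ∸ x) w → Descends c (replicate (y ∸ b) north ++ replicate (x ∸ a) east ++ w)
block-descends {a} {b} {c} {x} {y} w eq a≤x b≤y x≤y d = descends-norths (y ∸ b)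
  (subst (λ m → Descends m (replicate (x ∸ a) east ++ w)) height (descends-easts (x ∸ a) d))
  where
  open ≡-Reasoning
  height : (x ∸ a) + (y ∸ x) ≡ (y ∸ b) + c
  height = ℕₚ.+-cancelˡ-≡ a _ _ (begin
    a + ((x ∸ a) + (y ∸ x)) ≡⟨ sym (ℕₚ.+-assoc a _ _) ⟩
    a + (x ∸ a) + (y ∸ x)   ≡⟨ cong (_+ (y ∸ x)) (ℕₚ.m+[n∸m]≡n a≤x) ⟩
    x + (y ∸ x)             ≡⟨ ℕₚ.m+[n∸m]≡n x≤y ⟩
    y                       ≡⟨ sym (ℕₚ.m+[n∸m]≡n b≤y) ⟩
    b + (y ∸ b)             ≡⟨ cong (_+ (y ∸ b)) (sym eq) ⟩
    a + c + (y ∸ b)         ≡⟨ ℕₚ.+-assoc a c _ ⟩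
    a + (c + (y ∸ b))       ≡⟨ cong (a +_) (ℕₚ.+-comm c _) ⟩
    a + ((y ∸ b) + c)       ∎)

chain-descends : ∀ {n a b c xs ys} → Chain n a b xs ys → a + c ≡ b →
  Descends c (blocks a b (xs ∷ʳ n) (ys ∷ʳ n))
chain-descends {n} (end a<n b<n) eq =
  block-descends [] eq (ℕₚ.<⇒≤ a<n) (ℕₚ.<⇒≤ b<n) ℕₚ.≤-refl (ℕₚ.n∸n≡0 n)
chain-descends (step a<x b<y x≤y ch) eq =
  block-descends _ eq (ℕₚ.<⇒≤ a<x) (ℕₚ.<⇒≤ b<y) x≤y
    (chain-descends ch (ℕₚ.m+[n∸m]≡n x≤y))

block-norths : ∀ {b y n} k w → b ≤ y → y + #north w ≡ n →
  b + #north (replicate (y ∸ b) north ++ replicate k east ++ w) ≡ n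
block-norths {b} {y} {n} k w b≤y eq = begin
  b + #north (replicate (y ∸ b) north ++ replicate k east ++ w)
    ≡⟨ cong (b +_) (#north-norths (y ∸ b) _) ⟩
  b + ((y ∸ b) + #north (replicate k east ++ w))
    ≡⟨ cong (λ m → b + ((y ∸ b) + m)) (#north-easts k w) ⟩
  b + ((y ∸ b) + #north w) ≡⟨ sym (ℕₚ.+-assoc b _ _) ⟩
  b + (y ∸ b) + #north w   ≡⟨ cong (_+ #north w) (ℕₚ.m+[n∸m]≡n b≤y) ⟩
  y + #north w             ≡⟨ eq ⟩
  n                        ∎
  where open ≡-Reasoning

chain-norths : ∀ {n a b xs ys} → Chain n a b xs ys →
  b + #north (blocks a b (xs ∷ʳ n) (ys ∷ʳ n)) ≡ n
chain-norths {n} {a} (end a<n b<n) = block-norths (n ∸ a) [] (ℕₚ.<⇒≤ b<n) (ℕₚ.+-identityʳ n)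
chain-norths {a = a} (step {x = x} a<x b<y x≤y ch) =
  block-norths (x ∸ a) _ (ℕₚ.<⇒≤ b<y) (chain-norths ch)

fromChain : ∀ {n xs ys} → Chain n 0 0 xs ys → Dyck n
fromChain {n} {xs} {ys} ch =
  mkDyck (blocks 0 0 (xs ∷ʳ n) (ys ∷ʳ n)) (chain-norths ch) (chain-descends ch refl)

-- The valleys of a word read from the point (a , b), in order; valleysE
-- is used when the preceding step is east.
valleysN valleysE : ℕ → ℕ → List Step → List (ℕ × ℕ)
valleysN a b []          = []
valleysN a b (north ∷ w) = valleysN a (suc b) w
valleysN a b (east  ∷ w) = valleysE (suc a) b w
valleysE a b []          = []
valleysE a b (north ∷ w) = (a , b) ∷ valleysN a (suc b) w
valleysE a b (east  ∷ w) = valleysE (suc a) b w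

IsValleyFrom : ℕ → ℕ → List Step → Pred (ℕ × ℕ) 0ℓ
IsValleyFrom a b w (x , y) = ∃₂ λ u v →
  w ≡ u ++ east ∷ north ∷ v × x ≡ a + #east (u ∷ʳ east) × y ≡ b + #north (u ∷ʳ east)

ValleyFrom-north : ∀ {a b w p} → IsValleyFrom a (suc b) w p → IsValleyFrom a b (north ∷ w) p
ValleyFrom-north {b = b} (u , v , refl , refl , refl) = north ∷ u , v , refl , refl , sym (ℕₚ.+-suc b _)

ValleyFrom-east : ∀ {a b w p} → IsValleyFrom (suc a) b w p → IsValleyFrom a b (east ∷ w) p
ValleyFrom-east {a = a} (u , v , refl , refl , refl) = east ∷ u , v , refl , sym (ℕₚ.+-suc a _) , refl

valleysN-sound : ∀ a b w {p} → p ∈ valleysN a b w → IsValleyFrom a b w p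
valleysE-sound : ∀ a b w {p} → p ∈ valleysE (suc a) b w → IsValleyFrom a b (east ∷ w) p
valleysN-sound a b (north ∷ w) p∈ = ValleyFrom-north (valleysN-sound a (suc b) w p∈)
valleysN-sound a b (east ∷ w) p∈ = valleysE-sound a b w p∈
valleysE-sound a b (north ∷ w) (here refl) =
  [] , w , refl , ℕₚ.+-comm 1 a , sym (ℕₚ.+-identityʳ b)
valleysE-sound a b (north ∷ w) (there p∈) =
  ValleyFrom-east (ValleyFrom-north (valleysN-sound (suc a) (suc b) w p∈))
valleysE-sound a b (east ∷ w) p∈ = ValleyFrom-east (valleysE-sound (suc a) b w p∈)

valleysN-complete : ∀ a b u v →
  (a + #east (u ∷ʳ east) , b + #north (u ∷ʳ east)) ∈ valleysN a b (u ++ east ∷ north ∷ v)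
valleysE-complete : ∀ a b u v →
  (a + #east (u ∷ʳ east) , b + #north (u ∷ʳ east)) ∈ valleysE a b (u ++ east ∷ north ∷ v)
valleysN-complete a b [] v = here (cong₂ _,_ (ℕₚ.+-comm a 1) (ℕₚ.+-identityʳ b))
valleysN-complete a b (north ∷ u) v
  rewrite ℕₚ.+-suc b (#north (u ∷ʳ east)) = valleysN-complete a (suc b) u v
valleysN-complete a b (east ∷ u) v
  rewrite ℕₚ.+-suc a (#east (u ∷ʳ east)) = valleysE-complete (suc a) b u v
valleysE-complete a b [] v = here (cong₂ _,_ (ℕₚ.+-comm a 1) (ℕₚ.+-identityʳ b))
valleysE-complete a b (north ∷ u) v
  rewrite ℕₚ.+-suc b (#north (u ∷ʳ east)) = there (valleysN-complete a (suc b) u v)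
valleysE-complete a b (east ∷ u) v
  rewrite ℕₚ.+-suc a (#east (u ∷ʳ east)) = valleysE-complete (suc a) b u v

valleys : ∀ {n} → Dyck n → List (ℕ × ℕ)
valleys D = valleysN 0 0 (word D)

Valleys⇔valleys : ∀ {n} (D : Dyck n) → Valleys D ≐ (_∈ valleys D)
Valleys⇔valleys D = (λ { (u , v , eq , refl , refl) →
    subst (λ w → _ ∈ valleysN 0 0 w) (sym eq) (valleysN-complete 0 0 u v) })
  , valleysN-sound 0 0 (word D)

xs-of ys-of : ∀ {n} → Dyck n → List ℕ
xs-of D = map proj₁ (valleys D)
ys-of D = map proj₂ (valleys D)

SetX≐xs : ∀ {n} (D : Dyck n) → SetX D ≐ (_∈ xs-of D)
SetX≐xs D = (λ { (y , val) → ∈ₚ.∈-map⁺ proj₁ (proj₁ (Valleys⇔valleys D) val) })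
  , λ x∈ → let (_ , y) , p∈ , eq = ∈ₚ.∈-map⁻ proj₁ x∈ in
      y , proj₂ (Valleys⇔valleys D) (subst (λ x → (x , y) ∈ valleys D) (sym eq) p∈)

SetY≐ys : ∀ {n} (D : Dyck n) → SetY D ≐ (_∈ ys-of D)
SetY≐ys D = (λ { (x , val) → ∈ₚ.∈-map⁺ proj₂ (proj₁ (Valleys⇔valleys D) val) })
  , λ y∈ → let (x , _) , p∈ , eq = ∈ₚ.∈-map⁻ proj₂ y∈ in
      x , proj₂ (Valleys⇔valleys D) (subst (λ y → (x , y) ∈ valleys D) (sym eq) p∈)

valleysN-norths : ∀ k a b w → valleysN a b (replicate k north ++ w) ≡ valleysN a (k + b) w
valleysN-norths zero a b w = refl
valleysN-norths (suc k) a b w =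
  trans (valleysN-norths k a (suc b) w) (cong (λ m → valleysN a m w) (ℕₚ.+-suc k b))

valleysE-easts : ∀ k a b w → valleysE a b (replicate k east ++ w) ≡ valleysE (k + a) b w
valleysE-easts zero a b w = refl
valleysE-easts (suc k) a b w =
  trans (valleysE-easts k (suc a) b w) (cong (λ m → valleysE m b w) (ℕₚ.+-suc k a))

valleysN-easts : ∀ {a x} b w → a < x → valleysN a b (replicate (x ∸ a) east ++ w) ≡ valleysE x b w
valleysN-easts {a} {suc x} b w (s≤s a≤x) rewrite ℕₚ.+-∸-assoc 1 a≤x =
  trans (valleysE-easts (x ∸ a) (suc a) b w)
    (cong (λ m → valleysE m b w) (trans (ℕₚ.+-suc _ a) (cong suc (ℕₚ.m∸n+n≡m a≤x))))

valleysN-block : ∀ {a b x y} w → a < x → b ≤ y →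
  valleysN a b (replicate (y ∸ b) north ++ replicate (x ∸ a) east ++ w) ≡ valleysE x y w
valleysN-block {a} {b} {x} {y} w a<x b≤y = trans (valleysN-norths (y ∸ b) a b _)
  (trans (cong (λ m → valleysN a m (replicate (x ∸ a) east ++ w)) (ℕₚ.m∸n+n≡m b≤y))
    (valleysN-easts y w a<x))

valleysE-block : ∀ {a b x y} w → a < x → b < y →
  valleysE a b (replicate (y ∸ b) north ++ replicate (x ∸ a) east ++ w) ≡ (a , b) ∷ valleysE x y w
valleysE-block {a} {b} {x} {suc y} w a<x (s≤s b≤y) rewrite ℕₚ.+-∸-assoc 1 b≤y =
  cong ((a , b) ∷_) (valleysN-block {y = suc y} w a<x (s≤s b≤y))

chain-valleysE : ∀ {n a b xs ys} → Chain n a b xs ys →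
  valleysE a b (blocks a b (xs ∷ʳ n) (ys ∷ʳ n)) ≡ (a , b) ∷ zip xs ys
chain-valleysE (end a<n b<n) = valleysE-block [] a<n b<n
chain-valleysE (step a<x b<y x≤y ch) =
  trans (valleysE-block _ a<x b<y) (cong (_ ∷_) (chain-valleysE ch))

chain-valleysN : ∀ {n a b xs ys} → Chain n a b xs ys →
  valleysN a b (blocks a b (xs ∷ʳ n) (ys ∷ʳ n)) ≡ zip xs ys
chain-valleysN (end a<n b<n) = valleysN-block [] a<n (ℕₚ.<⇒≤ b<n)
chain-valleysN (step a<x b<y x≤y ch) =
  trans (valleysN-block _ a<x (ℕₚ.<⇒≤ b<y)) (chain-valleysE ch)

map-proj₁-zip : ∀ {n a b xs ys} → Chain n a b xs ys → map proj₁ (zip xs ys) ≡ xs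
map-proj₁-zip (end _ _) = refl
map-proj₁-zip (step _ _ _ ch) = cong (_ ∷_) (map-proj₁-zip ch)

map-proj₂-zip : ∀ {n a b xs ys} → Chain n a b xs ys → map proj₂ (zip xs ys) ≡ ys
map-proj₂-zip (end _ _) = refl
map-proj₂-zip (step _ _ _ ch) = cong (_ ∷_) (map-proj₂-zip ch)

xs-fromChain : ∀ {n xs ys} (ch : Chain n 0 0 xs ys) → xs-of (fromChain ch) ≡ xs
xs-fromChain ch = trans (cong (map proj₁) (chain-valleysN ch)) (map-proj₁-zip ch)

ys-fromChain : ∀ {n xs ys} (ch : Chain n 0 0 xs ys) → ys-of (fromChain ch) ≡ ys
ys-fromChain ch = trans (cong (map proj₂) (chain-valleysN ch)) (map-proj₂-zip ch)

valleysN-lower : ∀ a b w → All (λ (x , y) → a < x × b ≤ y) (valleysN a b w)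
valleysE-lower : ∀ a b w → All (λ (x , y) → a ≤ x × b ≤ y) (valleysE a b w)
valleysN-lower a b [] = []
valleysN-lower a b (north ∷ w) =
  All.map (λ (a<x , b<y) → a<x , ℕₚ.<⇒≤ b<y) (valleysN-lower a (suc b) w)
valleysN-lower a b (east ∷ w) = valleysE-lower (suc a) b w
valleysE-lower a b [] = []
valleysE-lower a b (north ∷ w) = (ℕₚ.≤-refl , ℕₚ.≤-refl) ∷
  All.map (λ (a<x , b<y) → ℕₚ.<⇒≤ a<x , ℕₚ.<⇒≤ b<y) (valleysN-lower a (suc b) w)
valleysE-lower a b (east ∷ w) =
  All.map (λ (a<x , b≤y) → ℕₚ.<⇒≤ a<x , b≤y) (valleysE-lower (suc a) b w)

_≪_ : ℕ × ℕ → ℕ × ℕ → Set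
(x , y) ≪ (x' , y') = x < x' × y < y'

valleysN-sorted : ∀ a b w → AllPairs _≪_ (valleysN a b w)
valleysE-sorted : ∀ a b w → AllPairs _≪_ (valleysE a b w)
valleysN-sorted a b [] = []
valleysN-sorted a b (north ∷ w) = valleysN-sorted a (suc b) w
valleysN-sorted a b (east ∷ w) = valleysE-sorted (suc a) b w
valleysE-sorted a b [] = []
valleysE-sorted a b (north ∷ w) = valleysN-lower a (suc b) w ∷ valleysN-sorted a (suc b) w
valleysE-sorted a b (east ∷ w) = valleysE-sorted (suc a) b w

valleysN-upper : ∀ {n} a b c w → a + c ≡ b → b + #north w ≡ n → Descends c w →
  All (λ (x , y) → x ≤ y × y < n) (valleysN a b w)
valleysE-upper : ∀ {n} a b c w → a + c ≡ b → b + #north w ≡ n → Descends c w →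
  All (λ (x , y) → x ≤ y × y < n) (valleysE a b w)
valleysN-upper a b c [] p q d = []
valleysN-upper a b c (north ∷ w) p q d = valleysN-upper a (suc b) (suc c) w
  (trans (ℕₚ.+-suc a c) (cong suc p)) (trans (sym (ℕₚ.+-suc b _)) q) d
valleysN-upper a b (suc c) (east ∷ w) p q d =
  valleysE-upper (suc a) b c w (trans (sym (ℕₚ.+-suc a c)) p) q d
valleysE-upper a b c [] p q d = []
valleysE-upper a b c (north ∷ w) p q d =
  (subst (a ≤_) p (ℕₚ.m≤m+n a c) , subst (b <_) q (ℕₚ.m<m+n b z<s)) ∷
  valleysN-upper a (suc b) (suc c) w
    (trans (ℕₚ.+-suc a c) (cong suc p)) (trans (sym (ℕₚ.+-suc b _)) q) d
valleysE-upper a b (suc c) (east ∷ w) p q d =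
  valleysE-upper (suc a) b c w (trans (sym (ℕₚ.+-suc a c)) p) q d

valleys-bounds : ∀ {n} (D : Dyck n) → All (λ (x , y) → 1 ≤ x × x ≤ y × y < n) (valleys D)
valleys-bounds D = All.zipWith (λ ((0<x , _) , x≤y , y<n) → 0<x , x≤y , y<n)
  ( valleysN-lower 0 0 (word D)
  , valleysN-upper 0 0 0 (word D) refl (norths D) (Dyck-descends D))

xs-sorted : ∀ {n} (D : Dyck n) → AllPairs _<_ (xs-of D)
xs-sorted D = AllPairsₚ.map⁺ (AllPairs.map proj₁ (valleysN-sorted 0 0 (word D)))

ys-sorted : ∀ {n} (D : Dyck n) → AllPairs _<_ (ys-of D)
ys-sorted D = AllPairsₚ.map⁺ (AllPairs.map proj₂ (valleysN-sorted 0 0 (word D)))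

xs-range : ∀ {n} (D : Dyck n) → All ([n-1] n) (xs-of D)
xs-range D = Allₚ.map⁺ (All.map (λ (p , q , r) → p , ℕₚ.≤-<-trans q r) (valleys-bounds D))

ys-range : ∀ {n} (D : Dyck n) → All ([n-1] n) (ys-of D)
ys-range D = Allₚ.map⁺ (All.map (λ (p , q , r) → ℕₚ.≤-trans p q , r) (valleys-bounds D))

xs≤ys : ∀ {n} (D : Dyck n) → Pointwise _≤_ (xs-of D) (ys-of D)
xs≤ys D = go (valleys-bounds D)
  where
  go : ∀ {n ps} → All (λ (x , y) → 1 ≤ x × x ≤ y × y < n) ps →
    Pointwise _≤_ (map proj₁ ps) (map proj₂ ps)
  go [] = []
  go ((_ , x≤y , _) ∷ all) = x≤y ∷ go all

module _ {n : ℕ} where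

  blocksOf : ℕ → ℕ → List (ℕ × ℕ) → List Step
  blocksOf a b ps = blocks a b (map proj₁ ps ∷ʳ n) (map proj₂ ps ∷ʳ n)

  north-shift : ∀ {b₀ b} w → b₀ ≤ b →
    replicate (suc b ∸ b₀) north ++ w ≡ replicate (b ∸ b₀) north ++ north ∷ w
  north-shift {b₀} {b} w b₀≤b rewrite ℕₚ.+-∸-assoc 1 b₀≤b = shift (b ∸ b₀)
    where
    shift : ∀ k → north ∷ replicate k north ++ w ≡ replicate k north ++ north ∷ w
    shift zero = refl
    shift (suc k) = cong (north ∷_) (shift k)

  east-shift : ∀ {a₀ a} w → a₀ ≤ a →
    replicate (suc a ∸ a₀) east ++ w ≡ replicate (a ∸ a₀) east ++ east ∷ w
  east-shift {a₀} {a} w a₀≤a rewrite ℕₚ.+-∸-assoc 1 a₀≤a = shift (a ∸ a₀)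
    where
    shift : ∀ k → east ∷ replicate k east ++ w ≡ replicate k east ++ east ∷ w
    shift zero = refl
    shift (suc k) = cong (east ∷_) (shift k)

  rebuildN : ∀ {b₀} a b w → b₀ ≤ b → a + #east w ≡ n → b + #north w ≡ n →
    blocksOf a b₀ (valleysN a b w) ≡ replicate (b ∸ b₀) north ++ w
  rebuildE : ∀ {a₀ b₀} a b w → a₀ ≤ a → b₀ ≤ b → a + #east w ≡ n → b + #north w ≡ n →
    blocksOf a₀ b₀ (valleysE a b w) ≡ replicate (b ∸ b₀) north ++ replicate (a ∸ a₀) east ++ w
  rebuildN {b₀} a b [] b₀≤b p q
    rewrite sym (trans (sym (ℕₚ.+-identityʳ a)) p) | trans (sym (ℕₚ.+-identityʳ b)) q
          | ℕₚ.n∸n≡0 a = refl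
  rebuildN {b₀} a b (north ∷ w) b₀≤b p q = trans
    (rebuildN a (suc b) w (ℕₚ.m≤n⇒m≤1+n b₀≤b) p (trans (sym (ℕₚ.+-suc b _)) q))
    (north-shift w b₀≤b)
  rebuildN {b₀} a b (east ∷ w) b₀≤b p q = trans
    (rebuildE (suc a) b w (ℕₚ.n≤1+n a) b₀≤b (trans (sym (ℕₚ.+-suc a _)) p) q)
    (cong (replicate (b ∸ b₀) north ++_)
      (trans (east-shift w (ℕₚ.≤-refl {a}))
        (cong (λ k → replicate k east ++ east ∷ w) (ℕₚ.n∸n≡0 a))))
  rebuildE {a₀} {b₀} a b [] a₀≤a b₀≤b p q
    rewrite trans (sym (ℕₚ.+-identityʳ a)) p | trans (sym (ℕₚ.+-identityʳ b)) q = refl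
  rebuildE {a₀} {b₀} a b (north ∷ w) a₀≤a b₀≤b p q =
    cong (λ v → replicate (b ∸ b₀) north ++ replicate (a ∸ a₀) east ++ v)
      (trans (rebuildN a (suc b) w (ℕₚ.n≤1+n b) p (trans (sym (ℕₚ.+-suc b _)) q))
        (trans (north-shift w (ℕₚ.≤-refl {b}))
          (cong (λ k → replicate k north ++ north ∷ w) (ℕₚ.n∸n≡0 b))))
  rebuildE {a₀} {b₀} a b (east ∷ w) a₀≤a b₀≤b p q = trans
    (rebuildE (suc a) b w (ℕₚ.m≤n⇒m≤1+n a₀≤a) b₀≤b (trans (sym (ℕₚ.+-suc a _)) p) q)
    (cong (replicate (b ∸ b₀) north ++_) (east-shift w a₀≤a))

rebuild : ∀ {n} (D : Dyck n) → blocks 0 0 (xs-of D ∷ʳ n) (ys-of D ∷ʳ n) ≡ word D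
rebuild D = rebuildN 0 0 (word D) z≤n (easts D) (norths D)

sorted-ext : ∀ {xs ys} → AllPairs _<_ xs → AllPairs _<_ ys →
  (∀ {v} → v ∈ xs → v ∈ ys) → (∀ {v} → v ∈ ys → v ∈ xs) → xs ≡ ys
sorted-ext {[]} {[]} _ _ _ _ = refl
sorted-ext {[]} {y ∷ ys} _ _ _ g with () ← g (here refl)
sorted-ext {x ∷ xs} {[]} _ _ f _ with () ← f (here refl)
sorted-ext {x ∷ xs} {y ∷ ys} (sx ∷ sxs) (sy ∷ sys) f g with x≡y
  where
  x≡y : x ≡ y
  x≡y with f (here refl) | g (here refl)
  ... | here eq | _ = eq
  ... | there _ | here eq = sym eq
  ... | there x∈ | there y∈ = contradiction (All.lookup sy x∈) (ℕₚ.<-asym (All.lookup sx y∈))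
... | refl = cong (x ∷_) (sorted-ext sxs sys f' g')
  where
  f' : ∀ {v} → v ∈ xs → v ∈ ys
  f' v∈ with f (there v∈)
  ... | here refl = contradiction (All.lookup sx v∈) (ℕₚ.<-irrefl refl)
  ... | there v∈' = v∈'
  g' : ∀ {v} → v ∈ ys → v ∈ xs
  g' v∈ with g (there v∈)
  ... | here refl = contradiction (All.lookup sy v∈) (ℕₚ.<-irrefl refl)
  ... | there v∈' = v∈'

≈-from-sets : ∀ {n} (D D' : Dyck n) → SetX D ≐ SetX D' → SetY D ≐ SetY D' → D ≈ D'
≈-from-sets {n} D D' (fx , gx) (fy , gy) = trans (sym (rebuild D))
  (trans (cong₂ (λ xs ys → blocks 0 0 (xs ∷ʳ n) (ys ∷ʳ n)) xs≡ ys≡) (rebuild D'))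
  where
  xs≡ : xs-of D ≡ xs-of D'
  xs≡ = sorted-ext (xs-sorted D) (xs-sorted D')
    (proj₁ (SetX≐xs D') ∘ fx ∘ proj₂ (SetX≐xs D))
    (proj₁ (SetX≐xs D) ∘ gx ∘ proj₂ (SetX≐xs D'))
  ys≡ : ys-of D ≡ ys-of D'
  ys≡ = sorted-ext (ys-sorted D) (ys-sorted D')
    (proj₁ (SetY≐ys D') ∘ fy ∘ proj₂ (SetY≐ys D))
    (proj₁ (SetY≐ys D) ∘ gy ∘ proj₂ (SetY≐ys D'))

-- P dominates Q along the list when every prefix contains at least as
-- many elements of P as of Q (given a head start of k), with equality
-- for the whole list.
data Dom (P Q : Pred ℕ 0ℓ) : ℕ → List ℕ → Set where
  []      : Dom P Q 0 []
  both    : ∀ {k o os} → P o → Q o → Dom P Q k os → Dom P Q k (o ∷ os)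
  neither : ∀ {k o os} → ¬ P o → ¬ Q o → Dom P Q k os → Dom P Q k (o ∷ os)
  left    : ∀ {k o os} → P o → ¬ Q o → Dom P Q (suc k) os → Dom P Q k (o ∷ os)
  right   : ∀ {k o os} → ¬ P o → Q o → Dom P Q k os → Dom P Q (suc k) (o ∷ os)

Dom-∁ : ∀ {P Q k os} → Dom P Q k os → Dom (∁ Q) (∁ P) k os
Dom-∁ [] = []
Dom-∁ (both p q d) = neither (λ ¬q → ¬q q) (λ ¬p → ¬p p) (Dom-∁ d)
Dom-∁ (neither ¬p ¬q d) = both ¬q ¬p (Dom-∁ d)
Dom-∁ (left p ¬q d) = left ¬q (λ ¬p → ¬p p) (Dom-∁ d)
Dom-∁ (right ¬p q d) = right (λ ¬q → ¬q q) ¬p (Dom-∁ d)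

module _ {P Q : Pred ℕ 0ℓ} (P? : Decidable P) (Q? : Decidable Q) where

  Dom⇒≤ : ∀ {k os} → Dom P Q k os → ∀ ps → length ps ≡ k → AllPairs _<_ os →
    All (λ p → All (p ≤_) os) ps → Pointwise _≤_ (ps ++ filter P? os) (filter Q? os)
  Dom⇒≤ [] [] _ _ _ = []
  Dom⇒≤ {os = o ∷ os} (both po qo d) [] eq (so ∷ sos) _
    rewrite Listₚ.filter-accept P? {xs = os} po | Listₚ.filter-accept Q? {xs = os} qo =
    ℕₚ.≤-refl ∷ Dom⇒≤ d [] eq sos []
  Dom⇒≤ {os = o ∷ os} (both po qo d) (p ∷ ps) eq (so ∷ sos) ((p≤o ∷ _) ∷ ps≤)
    rewrite Listₚ.filter-accept P? {xs = os} po | Listₚ.filter-accept Q? {xs = os} qo =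
    p≤o ∷ subst (λ l → Pointwise _≤_ l (filter Q? os)) (Listₚ.++-assoc ps [ o ] _)
      (Dom⇒≤ d (ps ∷ʳ o)
        (trans (Listₚ.length-++ ps) (trans (ℕₚ.+-comm _ 1) eq)) sos
        (Allₚ.∷ʳ⁺ (All.map All.tail ps≤) (All.map ℕₚ.<⇒≤ so)))
  Dom⇒≤ {os = o ∷ os} (neither ¬p ¬q d) ps eq (so ∷ sos) ps≤
    rewrite Listₚ.filter-reject P? {xs = os} ¬p | Listₚ.filter-reject Q? {xs = os} ¬q =
    Dom⇒≤ d ps eq sos (All.map All.tail ps≤)
  Dom⇒≤ {os = o ∷ os} (left po ¬q d) ps eq (so ∷ sos) ps≤
    rewrite Listₚ.filter-accept P? {xs = os} po | Listₚ.filter-reject Q? {xs = os} ¬q =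
    subst (λ l → Pointwise _≤_ l (filter Q? os)) (Listₚ.++-assoc ps [ o ] _)
      (Dom⇒≤ d (ps ∷ʳ o)
        (trans (Listₚ.length-++ ps) (trans (ℕₚ.+-comm _ 1) (cong suc eq))) sos
        (Allₚ.∷ʳ⁺ (All.map All.tail ps≤) (All.map ℕₚ.<⇒≤ so)))
  Dom⇒≤ {os = o ∷ os} (right ¬p qo d) (p ∷ ps) eq (so ∷ sos) ((p≤o ∷ _) ∷ ps≤)
    rewrite Listₚ.filter-reject P? {xs = os} ¬p | Listₚ.filter-accept Q? {xs = os} qo =
    p≤o ∷ Dom⇒≤ d ps (ℕₚ.suc-injective eq) sos (All.map All.tail ps≤)

  ≤⇒Dom : ∀ os ps → AllPairs _<_ os →
    Pointwise _≤_ (ps ++ filter P? os) (filter Q? os) → Dom P Q (length ps) os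
  ≤⇒Dom [] [] _ _ = []
  ≤⇒Dom (o ∷ os) ps (so ∷ sos) pw with P? o | Q? o
  ≤⇒Dom (o ∷ os) ps (so ∷ sos) pw | no ¬p | no ¬q = neither ¬p ¬q (≤⇒Dom os ps sos pw)
  ≤⇒Dom (o ∷ os) ps (so ∷ sos) pw | yes p | no ¬q = left p ¬q
    (subst (λ k → Dom P Q k os) (trans (Listₚ.length-++ ps) (ℕₚ.+-comm _ 1))
      (≤⇒Dom os (ps ∷ʳ o) sos
        (subst (λ l → Pointwise _≤_ l (filter Q? os)) (sym (Listₚ.++-assoc ps [ o ] _)) pw)))
  ≤⇒Dom (o ∷ os) [] (so ∷ sos) pw | no ¬p | yes q =
    contradiction pw (impossible (Allₚ.filter⁺ P? so))
    where
    impossible : ∀ {ls rs} → All (o <_) ls → ¬ Pointwise _≤_ ls (o ∷ rs)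
    impossible (o<l ∷ _) (l≤o ∷ _) = ℕₚ.<⇒≱ o<l l≤o
  ≤⇒Dom (o ∷ os) (r ∷ ps) (so ∷ sos) (_ ∷ pw) | no ¬p | yes q = right ¬p q (≤⇒Dom os ps sos pw)
  ≤⇒Dom (o ∷ os) [] (so ∷ sos) (_ ∷ pw) | yes p | yes q = both p q (≤⇒Dom os [] sos pw)
  ≤⇒Dom (o ∷ os) (r ∷ ps) (so ∷ sos) (_ ∷ pw) | yes p | yes q = both p q
    (subst (λ k → Dom P Q k os) (trans (Listₚ.length-++ ps) (ℕₚ.+-comm _ 1))
      (≤⇒Dom os (ps ∷ʳ o) sos
        (subst (λ l → Pointwise _≤_ l (filter Q? os)) (sym (Listₚ.++-assoc ps [ o ] _)) pw)))

  Dom-from-counts : ∀ k os →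
    (∀ m → length (filter Q? (take m os)) ≤ k + length (filter P? (take m os))) →
    length (filter Q? os) ≡ k + length (filter P? os) → Dom P Q k os
  Dom-from-counts k [] _ eq =
    subst (λ m → Dom P Q m []) (trans eq (ℕₚ.+-identityʳ k)) []
  Dom-from-counts k (o ∷ os) le eq with P? o | Q? o | (λ m → le (suc m))
  ... | no ¬p | no ¬q | le' = neither ¬p ¬q (Dom-from-counts k os le' eq)
  ... | yes p | no ¬q | le' = left p ¬q (Dom-from-counts (suc k) os
        (λ m → ℕₚ.≤-trans (le' m) (ℕₚ.≤-reflexive (ℕₚ.+-suc k _))) (trans eq (ℕₚ.+-suc k _)))
  ... | yes p | yes q | le' = both p q (Dom-from-counts k os
        (λ m → ℕₚ.≤-pred (ℕₚ.≤-trans (le' m) (ℕₚ.≤-reflexive (ℕₚ.+-suc k _))))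
        (ℕₚ.suc-injective (trans eq (ℕₚ.+-suc k _))))
  Dom-from-counts zero (o ∷ os) le eq | no ¬p | yes q | le' = contradiction (le' 0) (λ ())
  Dom-from-counts (suc k) (o ∷ os) le eq | no ¬p | yes q | le' = right ¬p q
    (Dom-from-counts k os (λ m → ℕₚ.≤-pred (le' m)) (ℕₚ.suc-injective eq))

[1⋯]-sorted : ∀ m → AllPairs _<_ [1⋯ m ]
[1⋯]-sorted m = AllPairsₚ.applyUpTo⁺₁ suc m (λ i<j _ → s≤s i<j)

[n-1]⇒∈ : ∀ {n i} → [n-1] n i → i ∈ [1⋯ n ∸ 1 ]
[n-1]⇒∈ {suc n} {suc i} (_ , s≤s i<n) = ∈ₚ.∈-applyUpTo⁺ suc i<n

∈⇒[n-1] : ∀ {n i} → i ∈ [1⋯ n ∸ 1 ] → [n-1] n i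
∈⇒[n-1] {suc n} i∈ with _ , j<n , refl ← ∈ₚ.∈-applyUpTo⁻ suc i∈ = s≤s z≤n , s≤s j<n

Dom⇒Chain : ∀ {n P Q} (P? : Decidable P) (Q? : Decidable Q) → 0 < n →
  Dom P Q 0 [1⋯ n ∸ 1 ] → Chain n 0 0 (filter P? [1⋯ n ∸ 1 ]) (filter Q? [1⋯ n ∸ 1 ])
Dom⇒Chain {n} P? Q? 0<n d = mkChain 0<n 0<n
  (Dom⇒≤ P? Q? d [] refl sorted [])
  (Allₚ.filter⁺ P? positive) (Allₚ.filter⁺ Q? positive)
  (AllPairsₚ.filter⁺ P? sorted) (AllPairsₚ.filter⁺ Q? sorted)
  (Allₚ.filter⁺ P? bounded) (Allₚ.filter⁺ Q? bounded)
  where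
  sorted : AllPairs _<_ [1⋯ n ∸ 1 ]
  sorted = [1⋯]-sorted (n ∸ 1)
  positive : All (0 <_) [1⋯ n ∸ 1 ]
  positive = All.tabulate (proj₁ ∘ ∈⇒[n-1] {n})
  bounded : All (_< n) [1⋯ n ∸ 1 ]
  bounded = All.tabulate (proj₂ ∘ ∈⇒[n-1] {n})

filter-∈ : ∀ {n xs} → AllPairs _<_ xs → All ([n-1] n) xs →
  filter (_∈? xs) [1⋯ n ∸ 1 ] ≡ xs
filter-∈ {n} {xs} sxs rxs = sorted-ext
  (AllPairsₚ.filter⁺ (_∈? xs) ([1⋯]-sorted (n ∸ 1))) sxs
  (proj₂ ∘ ∈ₚ.∈-filter⁻ (_∈? xs) {xs = [1⋯ n ∸ 1 ]})
  (λ v∈ → ∈ₚ.∈-filter⁺ (_∈? xs) ([n-1]⇒∈ (All.lookup rxs v∈)) v∈)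

Ψ-exists : ∀ {n} (D : Dyck n) → ∃ (IsΨ D)
Ψ-exists {zero} D = D
  , ((λ x∈ → contradiction (proj₂ (All.lookup (xs-range D) (proj₁ (SetX≐xs D) x∈))) λ ())
    , (λ ((_ , i<0) , _) → contradiction i<0 λ ()))
  , ((λ y∈ → contradiction (proj₂ (All.lookup (ys-range D) (proj₁ (SetY≐ys D) y∈))) λ ())
    , (λ ((_ , i<0) , _) → contradiction i<0 λ ()))
Ψ-exists {n@(suc m)} D = fromChain chain
  , ((λ x∈ → let p , q = ∈ₚ.∈-filter⁻ Y? {xs = [1⋯ m ]}
                   (subst (_ ∈_) (xs-fromChain chain) (proj₁ (SetX≐xs (fromChain chain)) x∈))
             in ∈⇒[n-1] p , q ∘ proj₁ (SetY≐ys D))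
    , (λ (r , ¬y) → proj₂ (SetX≐xs (fromChain chain)) (subst (_ ∈_) (sym (xs-fromChain chain))
        (∈ₚ.∈-filter⁺ Y? ([n-1]⇒∈ r) (¬y ∘ proj₂ (SetY≐ys D))))))
  , ((λ y∈ → let p , q = ∈ₚ.∈-filter⁻ X? {xs = [1⋯ m ]}
                   (subst (_ ∈_) (ys-fromChain chain) (proj₁ (SetY≐ys (fromChain chain)) y∈))
             in ∈⇒[n-1] p , q ∘ proj₁ (SetX≐xs D))
    , (λ (r , ¬x) → proj₂ (SetY≐ys (fromChain chain)) (subst (_ ∈_) (sym (ys-fromChain chain))
        (∈ₚ.∈-filter⁺ X? ([n-1]⇒∈ r) (¬x ∘ proj₂ (SetX≐xs D))))))
  where
  X? : Decidable (_∉ xs-of D)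
  X? = ∁? (_∈? xs-of D)
  Y? : Decidable (_∉ ys-of D)
  Y? = ∁? (_∈? ys-of D)
  chain : Chain n 0 0 (filter Y? [1⋯ m ]) (filter X? [1⋯ m ])
  chain = Dom⇒Chain Y? X? z<s (Dom-∁ (≤⇒Dom (_∈? xs-of D) (_∈? ys-of D) [1⋯ m ] []
    ([1⋯]-sorted m)
    (subst₂ (Pointwise _≤_) (sym (filter-∈ (xs-sorted D) (xs-range D)))
      (sym (filter-∈ (ys-sorted D) (ys-range D))) (xs≤ys D))))

≐-via : ∀ {P Q R : Pred ℕ 0ℓ} → P ≐ R → Q ≐ R → P ≐ Q
≐-via (f , f') (g , g') = g' ∘ f , f' ∘ g

Ψ-exists! : ∀ {n} (D : Dyck n) → ∃! _≈_ (IsΨ D)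
Ψ-exists! D = let D' , p , q = Ψ-exists D in
  D' , (p , q) , λ {D''} (p' , q') → ≈-from-sets D' D'' (≐-via p p') (≐-via q q')

-- flipOnto w [] is w read backwards with north and east exchanged.
flipOnto : List Step → List Step → List Step
flipOnto []          v = v
flipOnto (north ∷ w) v = flipOnto w (east ∷ v)
flipOnto (east  ∷ w) v = flipOnto w (north ∷ v)

flipOnto-++ : ∀ u t z → flipOnto (u ++ t) z ≡ flipOnto t (flipOnto u z)
flipOnto-++ [] t z = refl
flipOnto-++ (north ∷ u) t z = flipOnto-++ u t (east ∷ z)
flipOnto-++ (east ∷ u) t z = flipOnto-++ u t (north ∷ z)

flipOnto-onto : ∀ u v z → flipOnto u (v ++ z) ≡ flipOnto u v ++ z
flipOnto-onto [] v z = refl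
flipOnto-onto (north ∷ u) v z = flipOnto-onto u (east ∷ v) z
flipOnto-onto (east ∷ u) v z = flipOnto-onto u (north ∷ v) z

flipOnto-flipOnto : ∀ w v z → flipOnto (flipOnto w v) z ≡ flipOnto v (w ++ z)
flipOnto-flipOnto [] v z = refl
flipOnto-flipOnto (north ∷ w) v z = flipOnto-flipOnto w (east ∷ v) z
flipOnto-flipOnto (east ∷ w) v z = flipOnto-flipOnto w (north ∷ v) z

#north-flipOnto : ∀ w v → #north (flipOnto w v) ≡ #east w + #north v
#north-flipOnto [] v = refl
#north-flipOnto (north ∷ w) v = #north-flipOnto w (east ∷ v)
#north-flipOnto (east ∷ w) v = trans (#north-flipOnto w (north ∷ v)) (ℕₚ.+-suc _ _)

#east-flipOnto : ∀ w v → #east (flipOnto w v) ≡ #north w + #east v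
#east-flipOnto [] v = refl
#east-flipOnto (north ∷ w) v = trans (#east-flipOnto w (east ∷ v)) (ℕₚ.+-suc _ _)
#east-flipOnto (east ∷ w) v = #east-flipOnto w (north ∷ v)

flipOnto-descends : ∀ c w v → Descends c w → Descends c v → Descends 0 (flipOnto w v)
flipOnto-descends c [] v d e = subst (λ k → Descends k v) d e
flipOnto-descends c (north ∷ w) v d e = flipOnto-descends (suc c) w (east ∷ v) d e
flipOnto-descends (suc c) (east ∷ w) v d e = flipOnto-descends c w (north ∷ v) d e

flip-valley : ∀ {n x y} w → #north w ≡ n → #east w ≡ n →
  IsValley w (x , y) → IsValley (flipOnto w []) (n ∸ y , n ∸ x)
flip-valley {n} w nw ew (u , v , refl , refl , refl) =
  flipOnto v [] , flipOnto u [] , split , sym eastEq , sym northEq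
  where
  open ≡-Reasoning
  split : flipOnto (u ++ east ∷ north ∷ v) [] ≡ flipOnto v [] ++ east ∷ north ∷ flipOnto u []
  split = trans (flipOnto-++ u (east ∷ north ∷ v) []) (flipOnto-onto v [] _)
  eastEq : #east (flipOnto v [] ∷ʳ east) ≡ n ∸ #north (u ∷ʳ east)
  eastEq = begin
    #east (flipOnto v [] ∷ʳ east)   ≡⟨ cong #east (sym (flipOnto-onto v [] [ east ])) ⟩
    #east (flipOnto v [ east ])     ≡⟨ #east-flipOnto v [ east ] ⟩
    #north v + 1                    ≡⟨ ℕₚ.+-comm _ 1 ⟩
    suc (#north v)                  ≡⟨ sym (ℕₚ.m+n∸m≡n (#north u) _) ⟩
    #north u + suc (#north v) ∸ #north u
      ≡⟨ cong₂ _∸_ (trans (sym (#north-++ u _)) nw)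
           (sym (trans (#north-++ u [ east ]) (ℕₚ.+-identityʳ _))) ⟩
    n ∸ #north (u ∷ʳ east)          ∎
  northEq : #north (flipOnto v [] ∷ʳ east) ≡ n ∸ #east (u ∷ʳ east)
  northEq = begin
    #north (flipOnto v [] ∷ʳ east)  ≡⟨ cong #north (sym (flipOnto-onto v [] [ east ])) ⟩
    #north (flipOnto v [ east ])    ≡⟨ #north-flipOnto v [ east ] ⟩
    #east v + 0                     ≡⟨ ℕₚ.+-identityʳ _ ⟩
    #east v                         ≡⟨ sym (ℕₚ.m+n∸m≡n (suc (#east u)) _) ⟩
    suc (#east u) + #east v ∸ suc (#east u)
      ≡⟨ cong₂ _∸_ (trans (sym (ℕₚ.+-suc _ _)) (trans (sym (#east-++ u _)) ew))
           (sym (trans (#east-++ u [ east ]) (ℕₚ.+-comm _ 1))) ⟩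
    n ∸ #east (u ∷ʳ east)           ∎

reflect : ∀ {n} → Dyck n → Dyck n
reflect D = mkDyck (flipOnto (word D) [])
  (trans (#north-flipOnto (word D) []) (trans (ℕₚ.+-identityʳ _) (easts D)))
  (flipOnto-descends 0 (word D) [] (Dyck-descends D) refl)

reflect-correct : ∀ {n} (D : Dyck n) → IsReflection D (reflect D)
reflect-correct {n} D =
  (λ {(x , y)} val →
    let _ , x≤y , y<n = All.lookup (valleys-bounds (reflect D))
                          (proj₁ (Valleys⇔valleys (reflect D)) val)
        y≤n = ℕₚ.<⇒≤ y<n
    in n ∸ y , n ∸ x
     , subst (λ w → IsValley w (n ∸ y , n ∸ x))
         (trans (flipOnto-flipOnto (word D) [] []) (Listₚ.++-identityʳ (word D)))
         (flip-valley (word (reflect D)) (norths (reflect D)) (easts (reflect D)) val)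
     , sym (ℕₚ.m∸[m∸n]≡n (ℕₚ.≤-trans x≤y y≤n)) , sym (ℕₚ.m∸[m∸n]≡n y≤n))
  , λ { (i , j , val , refl , refl) → flip-valley (word D) (norths D) (easts D) val }

reflect-exists! : ∀ {n} (D : Dyck n) → ∃! _≈_ (IsReflection D)
reflect-exists! D = reflect D , reflect-correct D , λ {D'} (f' , g') →
  let f , g = reflect-correct D in ≈-from-sets (reflect D) D'
    ((λ (y , val) → y , g' (f val)) , (λ (y , val) → y , g (f' val)))
    ((λ (x , val) → x , g' (f val)) , (λ (x , val) → x , g (f' val)))

length-≤ : ∀ {A B : Set} (R : A → B → Set) {xs : List A} → Unique xs → (ys : List B) →
  (∀ {x x' y} → R x y → R x' y → x ≡ x') →
  (∀ {x} → x ∈ xs → ∃ λ y → y ∈ ys × R x y) → length xs ≤ length ys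
length-≤ R {[]} _ ys inj tot = z≤n
length-≤ R {x ∷ xs} (x∉ ∷ u) ys inj tot with tot (here refl)
... | y , y∈ , rxy with ∈ₚ.∈-∃++ y∈
... | ls , rs , refl = subst (suc (length xs) ≤_) len (s≤s (length-≤ R u (ls ++ rs) inj tot'))
  where
  len : suc (length (ls ++ rs)) ≡ length (ls ++ y ∷ rs)
  len = trans (cong suc (Listₚ.length-++ ls)) (trans (sym (ℕₚ.+-suc _ _)) (sym (Listₚ.length-++ ls)))
  tot' : ∀ {x'} → x' ∈ xs → ∃ λ y' → y' ∈ ls ++ rs × R x' y'
  tot' x'∈ with tot (there x'∈)
  ... | y' , y'∈ , rx'y' with ∈ₚ.∈-++⁻ ls y'∈
  ... | inj₁ p = y' , ∈ₚ.∈-++⁺ˡ p , rx'y'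
  ... | inj₂ (here refl) = contradiction (inj rxy rx'y') (All.lookup x∉ x'∈)
  ... | inj₂ (there p) = y' , ∈ₚ.∈-++⁺ʳ ls p , rx'y'

length-filter-∁ : ∀ {P : Pred ℕ 0ℓ} (P? : Decidable P) xs →
  length (filter P? xs) + length (filter (∁? P?) xs) ≡ length xs
length-filter-∁ P? [] = refl
length-filter-∁ P? (x ∷ xs) with P? x
... | yes _ = cong suc (length-filter-∁ P? xs)
... | no _ = trans (ℕₚ.+-suc _ _) (cong suc (length-filter-∁ P? xs))

take-[1⋯] : ∀ k m → take k [1⋯ m ] ≡ [1⋯ k ⊓ m ]
take-[1⋯] = go suc
  where
  go : ∀ (f : ℕ → ℕ) k m → take k (applyUpTo f m) ≡ applyUpTo f (k ⊓ m)
  go f zero m = refl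
  go f (suc k) zero = refl
  go f (suc k) (suc m) = cong (f 0 ∷_) (go (f ∘ suc) k m)

[1⋯]-unique : ∀ m → Unique [1⋯ m ]
[1⋯]-unique m = AllPairs.map ℕₚ.<⇒≢ ([1⋯]-sorted m)

module _ {n : ℕ} (σ : Permutation′ n) where

  private
    val pos : Fin n → Fin n
    val = σ ⟨$⟩ʳ_
    pos = σ ⟨$⟩ˡ_

  val-injective : ∀ {i j} → val i ≡ val j → i ≡ j
  val-injective eq = trans (sym (inverseˡ σ)) (trans (cong pos eq) (inverseˡ σ))

  pos-injective : ∀ {i j} → pos i ≡ pos j → i ≡ j
  pos-injective eq = trans (sym (inverseʳ σ)) (trans (cong val eq) (inverseʳ σ))

  module _ (av : Avoids231 σ) where

    -- Sends a descent with upper value v + 1 to v.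
    DesTo : ℕ → ℕ → Set
    DesTo i u = ∃ λ j → i ≡ suc (toℕ j) × u ≡ toℕ (val j)

    DesTo-injective : ∀ {i i' u} → DesTo i u → DesTo i' u → i ≡ i'
    DesTo-injective (j , refl , eq) (j' , refl , eq') =
      cong (suc ∘ toℕ) (val-injective (Finₚ.toℕ-injective (trans (sym eq) eq')))

    DesTo-total : ∀ {i} → Des σ i → ∃ λ u → [n-1] n u × iDes σ u × DesTo i u
    DesTo-total (j , k , refl , k≡ , vk<vj) =
      toℕ (val j) , (0<vj , Finₚ.toℕ<n _) , (p , val j , vj≡ , vj≡ , j<pos) , j , refl , refl
      where
      0<vj : 0 < toℕ (val j)
      0<vj = ℕₚ.≤-<-trans z≤n vk<vj
      vj≡' : suc (ℕ.pred (toℕ (val j))) ≡ toℕ (val j)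
      vj≡' = ℕₚ.suc-pred (toℕ (val j)) {{ℕ.>-nonZero 0<vj}}
      p<n : ℕ.pred (toℕ (val j)) < n
      p<n = subst (_≤ n) (sym vj≡') (ℕₚ.<⇒≤ (Finₚ.toℕ<n (val j)))
      p : Fin n
      p = fromℕ< p<n
      vj≡ : toℕ (val j) ≡ suc (toℕ p)
      vj≡ = trans (sym vj≡') (cong suc (sym (Finₚ.toℕ-fromℕ< p<n)))
      p<vj : p Fin.< val j
      p<vj = ℕₚ.≤-reflexive (sym vj≡)
      j<k : j Fin.< k
      j<k = ℕₚ.≤-reflexive (sym k≡)
      j<pos : pos (val j) Fin.< pos p
      j<pos rewrite inverseˡ σ {j} with Finₚ.<-cmp j (pos p)
      ... | tri< lt _ _ = lt
      ... | tri≈ _ eq _ = contradiction p<vj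
                            (ℕₚ.<-irrefl (cong toℕ (trans (sym (inverseʳ σ)) (cong val (sym eq)))))
      ... | tri> _ _ gt = contradiction (vk<vp , subst (Fin._< val j) (sym (inverseʳ σ)) p<vj)
                            (av (pos p) j k gt j<k)
        where
        vk<vp : val k Fin.< val (pos p)
        vk<vp = Finₚ.≤∧≢⇒<
          (subst (toℕ (val k) ≤_) (sym (cong toℕ (inverseʳ σ)))
            (ℕₚ.≤-pred (subst (suc (toℕ (val k)) ≤_) vj≡ vk<vj)))
          (λ eq → ℕₚ.<-irrefl (cong toℕ (sym (val-injective eq))) (ℕₚ.<-trans gt j<k))

    -- Sends an ascent i to u, where u + 1 is the least of the entries
    -- to the right of position i.
    AscTo : ℕ → ℕ → Set
    AscTo i u = ∃₂ λ j w → i ≡ suc (toℕ j) × u ≡ toℕ w × i ≤ toℕ (pos w) ×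
      (∀ v → v Fin.< w → toℕ (pos v) < i) × val j Fin.< w

    AscTo-injective : ∀ {i i' u} → AscTo i u → AscTo i' u → i ≡ i'
    AscTo-injective {i} {i'} (j , w , i≡ , u≡ , i≤ , below , vj<w) (j' , w' , i'≡ , u≡' , i'≤ , below' , vj'<w')
      with refl ← Finₚ.toℕ-injective (trans (sym u≡) u≡') with ℕₚ.<-cmp i i'
    ... | tri≈ _ eq _ = eq
    ... | tri< lt _ _ = contradiction (below (val j') vj'<w')
          (ℕₚ.≤⇒≯ (subst (i ≤_) (cong toℕ (sym (inverseˡ σ))) (ℕₚ.≤-pred (subst (suc i ≤_) i'≡ lt))))
    ... | tri> _ _ gt = contradiction (below' (val j) vj<w)
          (ℕₚ.≤⇒≯ (subst (i' ≤_) (cong toℕ (sym (inverseˡ σ))) (ℕₚ.≤-pred (subst (suc i' ≤_) i≡ gt))))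

    AscTo-total : ∀ {i} → [n-1] n i → ¬ Des σ i → ∃ λ u → 1 ≤ u × u ≤ i × ¬ iDes σ u × AscTo i u
    AscTo-total {suc i} (_ , si<n) ¬des = toℕ w
      , ℕₚ.≤-<-trans z≤n vj<w
      , Finₚ.injective⇒≤ {f = place} place-injective
      , ¬ides
      , j , w , cong suc (sym j≡) , refl , w-right , below , vj<w
      where
      i<n : i < n
      i<n = ℕₚ.<⇒≤ si<n
      j k : Fin n
      j = fromℕ< i<n
      k = fromℕ< si<n
      j≡ : toℕ j ≡ i
      j≡ = Finₚ.toℕ-fromℕ< i<n
      k≡ : toℕ k ≡ suc i
      k≡ = Finₚ.toℕ-fromℕ< si<n
      j<k : j Fin.< k
      j<k = subst₂ _<_ (sym j≡) (sym k≡) (ℕₚ.n<1+n i)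
      vj<vk : val j Fin.< val k
      vj<vk with Finₚ.<-cmp (val j) (val k)
      ... | tri< lt _ _ = lt
      ... | tri≈ _ eq _ = contradiction j<k (ℕₚ.<-irrefl (cong toℕ (val-injective eq)))
      ... | tri> _ _ gt = contradiction
            (j , k , cong suc (sym j≡) , trans k≡ (cong suc (sym j≡)) , gt) ¬des

      Left : Fin n → Set
      Left v = toℕ (pos v) < suc i

      least : ∃ λ w → ¬ Left w × ((v : Fin′ w) → Left (inject v))
      least = Finₚ.¬∀⟶∃¬-smallest n Left (λ v → toℕ (pos v) ℕₚ.<? suc i)
        (λ all → ℕₚ.<-irrefl (trans (cong toℕ (inverseˡ σ)) k≡) (all (val k)))
      w : Fin n
      w = proj₁ least
      w-right : suc i ≤ toℕ (pos w)
      w-right = ℕₚ.≮⇒≥ (proj₁ (proj₂ least))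
      below : ∀ v → v Fin.< w → Left v
      below v v<w = subst Left
        (Finₚ.toℕ-injective (trans (Finₚ.toℕ-inject (fromℕ< v<w)) (Finₚ.toℕ-fromℕ< v<w)))
        (proj₂ (proj₂ least) (fromℕ< v<w))

      vj<w : val j Fin.< w
      vj<w with Finₚ.<-cmp (val j) w
      ... | tri< lt _ _ = lt
      ... | tri≈ _ eq _ = contradiction w-right (ℕₚ.<⇒≱ (s≤s (ℕₚ.≤-reflexive
            (trans (cong toℕ (trans (cong pos (sym eq)) (inverseˡ σ))) j≡))))
      ... | tri> _ _ gt = contradiction
            (subst (Fin._< val j) (sym (inverseʳ σ)) gt , vj<vk)
            (av j k (pos w) j<k (Finₚ.≤∧≢⇒< (subst (_≤ toℕ (pos w)) (sym k≡) w-right) k≢pw))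
        where
        k≢pw : k ≢ pos w
        k≢pw eq = ℕₚ.<-asym vj<vk
          (subst (Fin._< val j) (trans (sym (inverseʳ σ)) (cong val (sym eq))) gt)

      place : Fin (toℕ w) → Fin (suc i)
      place v = fromℕ< (proj₂ (proj₂ least) v)
      place-injective : ∀ {v v'} → place v ≡ place v' → v ≡ v'
      place-injective {v} {v'} eq = Finₚ.toℕ-injective (trans (sym (Finₚ.toℕ-inject v))
        (trans (cong toℕ (pos-injective (Finₚ.toℕ-injective
          (trans (sym (Finₚ.toℕ-fromℕ< (proj₂ (proj₂ least) v)))
            (trans (cong toℕ eq) (Finₚ.toℕ-fromℕ< (proj₂ (proj₂ least) v')))))))
          (Finₚ.toℕ-inject v')))

      ¬ides : ¬ iDes σ (toℕ w)
      ¬ides (j' , k' , w≡ , k'≡ , lt)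
        with refl ← Finₚ.toℕ-injective (trans w≡ (sym k'≡)) =
        ℕₚ.<-asym lt (ℕₚ.<-≤-trans (below j' (ℕₚ.≤-reflexive (sym w≡))) w-right)

    count-total : length (desList σ) ≤ length (iDesList σ)
    count-total = length-≤ DesTo (Uniqueₚ.filter⁺ (Des? σ) ([1⋯]-unique (n ∸ 1))) (iDesList σ)
      DesTo-injective λ i∈ →
        let u , r , ides , to = DesTo-total (proj₂ (∈ₚ.∈-filter⁻ (Des? σ) {xs = [1⋯ n ∸ 1 ]} i∈))
        in u , ∈ₚ.∈-filter⁺ (iDes? σ) ([n-1]⇒∈ r) ides , to

    count-prefix : ∀ m → m ≤ n ∸ 1 →
      length (filter (iDes? σ) [1⋯ m ]) ≤ length (filter (Des? σ) [1⋯ m ])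
    count-prefix m m≤ = ℕₚ.+-cancelʳ-≤ (length (filter (∁? (Des? σ)) [1⋯ m ])) _ _
      (ℕₚ.≤-trans (ℕₚ.+-monoʳ-≤ (length (filter (iDes? σ) [1⋯ m ])) ascents)
        (ℕₚ.≤-reflexive (trans (length-filter-∁ (iDes? σ) [1⋯ m ])
          (sym (length-filter-∁ (Des? σ) [1⋯ m ])))))
      where
      ascents : length (filter (∁? (Des? σ)) [1⋯ m ]) ≤ length (filter (∁? (iDes? σ)) [1⋯ m ])
      ascents = length-≤ AscTo (Uniqueₚ.filter⁺ (∁? (Des? σ)) ([1⋯]-unique m)) _ AscTo-injective
        λ {i} i∈ →
          let i∈[1⋯m] , ¬des = ∈ₚ.∈-filter⁻ (∁? (Des? σ)) {xs = [1⋯ m ]} i∈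
              1≤i , i<1+m = ∈⇒[n-1] {suc m} i∈[1⋯m]
              i<n = ℕₚ.<-≤-trans i<1+m (below-n i∈[1⋯m])
              u , 1≤u , u≤i , ¬ides , to = AscTo-total (1≤i , i<n) ¬des
          in u , ∈ₚ.∈-filter⁺ (∁? (iDes? σ))
                   ([n-1]⇒∈ {suc m} (1≤u , ℕₚ.≤-<-trans u≤i i<1+m)) ¬ides , to
        where
        below-n : ∀ {i} → i ∈ [1⋯ m ] → suc m ≤ n
        below-n i∈ = lemma n m≤ (∈⇒[n-1] {suc m} i∈)
          where
          lemma : ∀ {i} n → m ≤ n ∸ 1 → [n-1] (suc m) i → suc m ≤ n
          lemma (suc n) m≤n _ = s≤s m≤n
          lemma zero z≤n (s≤s _ , s≤s ())

    Des-dominates : Dom (Des σ) (iDes σ) 0 [1⋯ n ∸ 1 ]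
    Des-dominates = Dom-from-counts (Des? σ) (iDes? σ) 0 [1⋯ n ∸ 1 ]
      (λ m → subst (λ l → length (filter (iDes? σ) l) ≤ length (filter (Des? σ) l))
        (sym (take-[1⋯] m (n ∸ 1))) (count-prefix (m ⊓ (n ∸ 1)) (ℕₚ.m⊓n≤n m _)))
      (ℕₚ.≤-antisym (count-prefix (n ∸ 1) ℕₚ.≤-refl) count-total)

Φ-descends : ∀ {n} (σ : Permutation′ n) → Avoids231 σ →
  #north (Φ-word σ) ≡ n × Descends 0 (Φ-word σ)
Φ-descends {zero} σ av = refl , refl
Φ-descends {suc m} σ av = chain-norths chain , chain-descends chain refl
  where
  chain : Chain (suc m) 0 0 (desList σ) (iDesList σ)
  chain = Dom⇒Chain (Des? σ) (iDes? σ) z<s (Des-dominates σ av)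

κ-height-step : ∀ {n} (σ : Permutation′ n) → Avoids132 σ → ∀ (i j : Fin n) →
  toℕ j ≡ suc (toℕ i) → κ-height σ i ≤ suc (κ-height σ j)
κ-height-step {n} σ av i j j≡ = length-≤ _≡_
  (Uniqueₚ.filter⁺ (larger-right? σ i) (Uniqueₚ.allFin⁺ n))
  (j ∷ filter (larger-right? σ j) (allFin n))
  (λ p q → trans p (sym q))
  (λ {l} l∈ → l , member l (proj₂ (∈ₚ.∈-filter⁻ (larger-right? σ i) {xs = allFin n} l∈)) , refl)
  where
  i<j : i Fin.< j
  i<j = ℕₚ.≤-reflexive (sym j≡)
  member : ∀ l → i Fin.< l × σ ⟨$⟩ʳ i Fin.< σ ⟨$⟩ʳ l →
    l ∈ j ∷ filter (larger-right? σ j) (allFin n)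
  member l (i<l , lt) with Finₚ.<-cmp j l
  ... | tri≈ _ refl _ = here refl
  ... | tri> _ _ l<j = contradiction (ℕₚ.≤-pred (subst (suc (toℕ l) ≤_) j≡ l<j)) (ℕₚ.<⇒≱ i<l)
  ... | tri< j<l _ _ with Finₚ.<-cmp (σ ⟨$⟩ʳ j) (σ ⟨$⟩ʳ l)
  ... | tri< lt' _ _ = there (∈ₚ.∈-filter⁺ (larger-right? σ j) (∈ₚ.∈-allFin l) (j<l , lt'))
  ... | tri≈ _ eq _ = contradiction j<l (ℕₚ.<-irrefl (cong toℕ (val-injective σ eq)))
  ... | tri> _ _ gt = contradiction (lt , gt) (av i j l i<j j<l)

κ-height-last : ∀ {n} (σ : Permutation′ n) (i : Fin n) → suc (toℕ i) ≡ n → κ-height σ i ≡ 0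
κ-height-last {n} σ i eq = cong length (Listₚ.filter-none (larger-right? σ i) {xs = allFin n}
  (All.tabulate λ {l} _ (i<l , _) → ℕₚ.<⇒≱ (Finₚ.toℕ<n l) (subst (_≤ toℕ l) eq i<l)))

κ-read-easts : ∀ c hs → #east (κ-read c hs) ≡ length hs
κ-read-easts c [] = refl
κ-read-easts c (h ∷ hs) = trans (go (suc h ∸ c)) (cong suc (κ-read-easts h hs))
  where
  go : ∀ k → #east (replicate k north ++ east ∷ κ-read h hs) ≡ suc (#east (κ-read h hs))
  go zero = refl
  go (suc k) = go k

κ-read-descends : ∀ n c (f : Fin n → ℕ) →
  (∀ i → toℕ i ≡ 0 → c ≤ suc (f i)) → (n ≡ 0 → c ≡ 0) →
  (∀ i j → toℕ j ≡ suc (toℕ i) → f i ≤ suc (f j)) →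
  (∀ i → suc (toℕ i) ≡ n → f i ≡ 0) → Descends c (κ-read c (tabulate f))
κ-read-descends zero c f start empty next last = empty refl
κ-read-descends (suc n) c f start empty next last = descends-norths (suc (f zero) ∸ c)
  (subst (λ h → Descends h (east ∷ κ-read (f zero) (tabulate (f ∘ suc))))
    (sym (ℕₚ.m∸n+n≡m (start zero refl)))
    (κ-read-descends n (f zero) (f ∘ suc)
      (λ i eq → next zero (suc i) (cong suc eq))
      (λ eq → last zero (cong suc (sym eq)))
      (λ i j eq → next (suc i) (suc j) (cong suc eq))
      (λ i eq → last (suc i) (cong suc eq))))

κ-descends : ∀ {n} (σ : Permutation′ n) → Avoids132 σ → Descends 0 (κ-word σ)
κ-descends {n} σ av = κ-read-descends n 0 (κ-height σ)
  (λ _ _ → z≤n) (λ _ → refl) (κ-height-step σ av) (κ-height-last σ)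

reverse-avoids : ∀ {n} (σ : Permutation′ n) → Avoids132 σ → Avoids231 (reverse ∘ₚ σ)
reverse-avoids σ av i j k i<j j<k (lt , lt') =
  av (opposite k) (opposite j) (opposite i) (opposite-< j<k) (opposite-< i<j) (lt , lt')
  where
  opposite-< : ∀ {n} {i j : Fin n} → i Fin.< j → opposite j Fin.< opposite i
  opposite-< {n} {i} {j} i<j = subst₂ _<_ (sym (Finₚ.opposite-prop j)) (sym (Finₚ.opposite-prop i))
    (ℕₚ.∸-monoʳ-< (s≤s i<j) (Finₚ.toℕ<n j))

ρ : ∀ {n} → S132 n → S231 n
ρ (σ , av) = reverse ∘ₚ σ , reverse-avoids σ av

Φ : ∀ {n} → S231 n → Dyck n
Φ (σ , av) = let north≡ , descends = Φ-descends σ av in mkDyck (Φ-word σ) north≡ descends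

κ : ∀ {n} → S132 n → Dyck n
κ {n} (σ , av) = mkDyck (κ-word σ)
  (trans (sym (descends-total 0 (κ-word σ) (κ-descends σ av)))
    (trans (κ-read-easts 0 (tabulate (κ-height σ))) (Listₚ.length-tabulate (κ-height σ))))
  (κ-descends σ av)

Ψ : ∀ {n} → Dyck n → Dyck n
Ψ D = proj₁ (Ψ-exists! D)

reflection : ∀ {n} → Dyck n → Dyck n
reflection D = proj₁ (reflect-exists! D)

ψ : ∀ {n} → Dyck n → Dyck n
ψ = reflection ∘ Ψ

{-# OPTIONS --safe #-}
module Submission where

-- A Dyck path is determined by the x- and the y-coordinates of its valleys,
-- and on both sides these sets turn out to be Des σ and
-- { n - u : u in iDes σ }.
--
-- For ψ ∘ Φ ∘ ρ this is formal.  The valleys of Φ τ have coordinate sets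
-- Des τ and iDes τ, and Ψ followed by the reflection turns coordinate sets
-- X and Y into the sets n - ([n-1] - X) and n - ([n-1] - Y)
-- (ψ-SetX, ψ-SetY).  If τ is the reversal of σ, then i is an ascent of τ
-- exactly when n - i is a descent of σ, and i is an ascent of the inverse of
-- τ exactly when i is a descent of the inverse of σ.
--
-- For κ, the east step created by the entry at position i ends at the point
-- (i , i + hᵢ), and it is followed by a north step exactly when
-- hᵢ ≤ hᵢ₊₁, that is, when i is a descent (κ-height-Des, Des-κ-height).  So
-- the valleys of κ σ are the points (i , i + hᵢ) with i in Des σ.  It
-- remains to see that the numbers n - i - hᵢ, for i in Des σ, are the
-- elements of iDes σ.  Now n - i - hᵢ counts the entries that lie to the right
-- of position i and are smaller than σᵢ.  As σ avoids 132, an entry left of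
-- position i is larger than all of these, so they are the values 1, …, u for
-- some u (Cut).  When i is a descent, u ≥ 1 and u + 1 does not lie to the
-- right of i, so u is in iDes σ (Des⇒Cut).  Conversely, for u in iDes σ the
-- position immediately before the leftmost of the values 1, …, u is a descent
-- cutting off exactly these values (iDes⇒Cut).

open import Data.Nat using (ℕ; _≤_)
open import Defs

open import Data.Nat using (zero; suc; _+_; _∸_; _<_; z≤n; s≤s; z<s)
import Data.Nat.Properties as ℕₚ
open import Data.Fin using (Fin; zero; suc; toℕ; fromℕ<; inject; opposite)
import Data.Fin as Fin
import Data.Fin.Properties as Finₚ
open import Data.Fin.Permutation using (Permutation′; _⟨$⟩ʳ_; _⟨$⟩ˡ_; inverseˡ; inverseʳ; flip; reverse; _∘ₚ_)
  renaming (id to idₚ)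
open import Data.List using (List; []; _∷_; _∷ʳ_; length; map; filter; zip; tabulate; allFin; upTo)
import Data.List.Properties as Listₚ
open import Data.List.Membership.Propositional using (_∈_)
import Data.List.Membership.Propositional.Properties as ∈ₚ
open import Data.List.Relation.Unary.Any using (here; there)
import Data.List.Relation.Unary.All.Properties as Allₚ
import Data.List.Relation.Unary.AllPairs as AllPairs
import Data.List.Relation.Unary.Unique.Propositional.Properties as Uniqueₚ
open import Data.Product using (∃; ∃₂; _×_; _,_; proj₁; proj₂)
open import Data.Sum using (_⊎_; inj₁; inj₂)
open import Function using (_∘_; id)
open import Relation.Binary using (tri<; tri≈; tri>)
open import Relation.Binary.PropositionalEquality
open import Relation.Nullary using (¬_; yes; no; contradiction; ¬?)
open import Relation.Nullary.Decidable using (_×-dec_; decidable-stable; toSum)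
open import Relation.Unary using (Pred; Decidable; _≐_)
open import Relation.Unary.Properties using (∁?)
open import Level using (0ℓ)

-- Ascents and descents

-- The counterpart of Des for ascents.
Asc : ∀ {n} → Permutation′ n → Pred ℕ 0ℓ
Asc {n} σ i = ∃₂ λ (j k : Fin n) →
  i ≡ suc (toℕ j) × toℕ k ≡ suc (toℕ j) × σ ⟨$⟩ʳ j Fin.< σ ⟨$⟩ʳ k

module _ {n : ℕ} (σ : Permutation′ n) where

  Asc-range : ∀ {i} → Asc σ i → [n-1] n i
  Asc-range (j , k , refl , k≡ , _) = s≤s z≤n , subst (_< n) k≡ (Finₚ.toℕ<n k)

  Asc⇒¬Des : ∀ {i} → Asc σ i → ¬ Des σ i
  Asc⇒¬Des (j , k , i≡ , k≡ , lt) (j' , k' , i≡' , k≡' , gt)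
    with refl ← Finₚ.toℕ-injective (ℕₚ.suc-injective (trans (sym i≡) i≡'))
    with refl ← Finₚ.toℕ-injective (trans k≡ (sym k≡')) = ℕₚ.<-asym lt gt

  ¬Des⇒Asc : ∀ {i} → [n-1] n i → ¬ Des σ i → Asc σ i
  ¬Des⇒Asc {suc i} (_ , si<n) ¬des = j , k , cong suc (sym j≡) , k≡j , lt
    where
    i<n : i < n
    i<n = ℕₚ.<⇒≤ si<n
    j k : Fin n
    j = fromℕ< i<n
    k = fromℕ< si<n
    j≡ : toℕ j ≡ i
    j≡ = Finₚ.toℕ-fromℕ< i<n
    k≡j : toℕ k ≡ suc (toℕ j)
    k≡j = trans (Finₚ.toℕ-fromℕ< si<n) (cong suc (sym j≡))
    lt : σ ⟨$⟩ʳ j Fin.< σ ⟨$⟩ʳ k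
    lt with Finₚ.<-cmp (σ ⟨$⟩ʳ j) (σ ⟨$⟩ʳ k)
    ... | tri< vj<vk _ _ = vj<vk
    ... | tri≈ _ eq _ = contradiction (sym (trans (cong toℕ (val-injective σ eq)) k≡j)) ℕₚ.1+n≢n
    ... | tri> _ _ gt = contradiction (j , k , cong suc (sym j≡) , k≡j , gt) ¬des

opposite-< : ∀ {n} {i j : Fin n} → i Fin.< j → opposite j Fin.< opposite i
opposite-< {n} {i} {j} i<j = subst₂ _<_ (sym (Finₚ.opposite-prop j)) (sym (Finₚ.opposite-prop i))
  (ℕₚ.∸-monoʳ-< (s≤s i<j) (Finₚ.toℕ<n j))

opposite-suc : ∀ {n} {j k : Fin n} → toℕ k ≡ suc (toℕ j) →
  n ∸ suc (toℕ j) ≡ suc (toℕ (opposite k))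
opposite-suc {n} {j} {k} k≡ = begin
  n ∸ suc (toℕ j)          ≡⟨ cong (n ∸_) k≡ ⟨
  n ∸ toℕ k                ≡⟨ ℕₚ.+-∸-assoc 1 (Finₚ.toℕ<n k) ⟩
  suc (n ∸ suc (toℕ k))    ≡⟨ cong suc (Finₚ.opposite-prop k) ⟨
  suc (toℕ (opposite k))   ∎
  where open ≡-Reasoning

opposite-adjacent : ∀ {n} {j k : Fin n} → toℕ k ≡ suc (toℕ j) →
  toℕ (opposite j) ≡ suc (toℕ (opposite k))
opposite-adjacent {j = j} k≡ = trans (Finₚ.opposite-prop j) (opposite-suc k≡)

module _ {n : ℕ} (σ : Permutation′ n) where

  Asc-reverse⇒Des : ∀ {i} → Asc (reverse ∘ₚ σ) i → Des σ (n ∸ i)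
  Asc-reverse⇒Des (j , k , refl , k≡ , lt) =
    opposite k , opposite j , opposite-suc k≡ , opposite-adjacent k≡ , lt

  Des⇒Asc-reverse : ∀ {i} → Des σ i → Asc (reverse ∘ₚ σ) (n ∸ i)
  Des⇒Asc-reverse (j , k , refl , k≡ , gt) =
    opposite k , opposite j , opposite-suc k≡ , opposite-adjacent k≡ ,
    subst₂ Fin._<_ (cong (σ ⟨$⟩ʳ_) (sym (Finₚ.opposite-involutive k)))
      (cong (σ ⟨$⟩ʳ_) (sym (Finₚ.opposite-involutive j))) gt

  -- The inverse of the reversal is the complement of the inverse.
  Asc-flip-reverse⇒iDes : ∀ {i} → Asc (flip (reverse ∘ₚ σ)) i → iDes σ i
  Asc-flip-reverse⇒iDes (j , k , i≡ , k≡ , lt) = j , k , i≡ , k≡ ,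
    subst₂ Fin._<_ (Finₚ.opposite-involutive (σ ⟨$⟩ˡ k)) (Finₚ.opposite-involutive (σ ⟨$⟩ˡ j))
      (opposite-< lt)

  iDes⇒Asc-flip-reverse : ∀ {i} → iDes σ i → Asc (flip (reverse ∘ₚ σ)) i
  iDes⇒Asc-flip-reverse (j , k , i≡ , k≡ , gt) = j , k , i≡ , k≡ , opposite-< gt

-- Valleys of ψ ∘ Φ ∘ ρ

module _ {n : ℕ} (D : Dyck n) where

  private
    isΨ : IsΨ D (Ψ D)
    isΨ = proj₁ (proj₂ (Ψ-exists! D))
    isReflection : IsReflection (Ψ D) (ψ D)
    isReflection = proj₁ (proj₂ (reflect-exists! (Ψ D)))

  ψ-SetX : SetX (ψ D) ≐ λ x → ∃ λ i → [n-1] n i × ¬ SetX D i × x ≡ n ∸ i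
  ψ-SetX =
    (λ (_ , val) → let x' , i , val' , x≡ , _ = proj₁ isReflection val
                       r , ¬x = proj₁ (proj₂ isΨ) (x' , val')
                   in i , r , ¬x , x≡)
    , λ { (i , r , ¬x , refl) → let x' , val' = proj₂ (proj₂ isΨ) (r , ¬x)
                                in n ∸ x' , proj₂ isReflection (x' , i , val' , refl , refl) }

  ψ-SetY : SetY (ψ D) ≐ λ y → ∃ λ i → [n-1] n i × ¬ SetY D i × y ≡ n ∸ i
  ψ-SetY =
    (λ (_ , val) → let i , y' , val' , _ , y≡ = proj₁ isReflection val
                       r , ¬y = proj₁ (proj₁ isΨ) (y' , val')
                   in i , r , ¬y , y≡)
    , λ { (i , r , ¬y , refl) → let y' , val' = proj₂ (proj₁ isΨ) (r , ¬y)
                                in n ∸ y' , proj₂ isReflection (i , y' , val' , refl , refl) }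

module _ {n : ℕ} (τ : Permutation′ n) where

  ∈-desList : (_∈ desList τ) ≐ Des τ
  ∈-desList = (λ i∈ → proj₂ (∈ₚ.∈-filter⁻ (Des? τ) {xs = [1⋯ n ∸ 1 ]} i∈))
    , λ { des@(j , k , refl , k≡ , _) → ∈ₚ.∈-filter⁺ (Des? τ)
            ([n-1]⇒∈ (s≤s z≤n , subst (_< n) k≡ (Finₚ.toℕ<n k))) des }

-- The coordinate sets of the path built from a chain.  Taking the path and
-- the equation for its word as arguments keeps the proof that it is a Dyck
-- path opaque.
module _ {n : ℕ} {xs ys : List ℕ} (ch : Chain n 0 0 xs ys) (D : Dyck n)
  (built : word D ≡ blocks 0 0 (xs ∷ʳ n) (ys ∷ʳ n)) where

  private
    valleys≡ : valleys D ≡ zip xs ys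
    valleys≡ = trans (cong (valleysN 0 0) built) (chain-valleysN ch)

    xs≡ : xs-of D ≡ xs
    xs≡ = trans (cong (map proj₁) valleys≡) (map-proj₁-zip ch)

    ys≡ : ys-of D ≡ ys
    ys≡ = trans (cong (map proj₂) valleys≡) (map-proj₂-zip ch)

  SetX-chain : SetX D ≐ (_∈ xs)
  SetX-chain = (λ x∈ → subst (_ ∈_) xs≡ (proj₁ (SetX≐xs D) x∈))
    , λ x∈ → proj₂ (SetX≐xs D) (subst (_ ∈_) (sym xs≡) x∈)

  SetY-chain : SetY D ≐ (_∈ ys)
  SetY-chain = (λ y∈ → subst (_ ∈_) ys≡ (proj₁ (SetY≐ys D) y∈))
    , λ y∈ → proj₂ (SetY≐ys D) (subst (_ ∈_) (sym ys≡) y∈)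

module _ {m : ℕ} (τ : Permutation′ (suc m)) (av : Avoids231 τ) where

  private
    chain : Chain (suc m) 0 0 (desList τ) (iDesList τ)
    chain = Dom⇒Chain (Des? τ) (iDes? τ) z<s (Des-dominates τ av)

  SetX-Φ : SetX (Φ (τ , av)) ≐ Des τ
  SetX-Φ = let f , g = SetX-chain chain (Φ (τ , av)) refl
               f' , g' = ∈-desList τ
           in f' ∘ f , g ∘ g'

  SetY-Φ : SetY (Φ (τ , av)) ≐ iDes τ
  SetY-Φ = let f , g = SetY-chain chain (Φ (τ , av)) refl
               f' , g' = ∈-desList (flip τ)
           in f' ∘ f , g ∘ g'

-- If the coordinate sets of D are the descents and the inverse descents of
-- the reversal of σ, their complements are its ascents and inverse ascents.
-- The coordinates of the valleys of ψ D are the differences of n and these.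
module _ {n : ℕ} (σ : Permutation′ n) (D : Dyck n) where

  SetX-ψ-reverse : SetX D ≐ Des (reverse ∘ₚ σ) → SetX (ψ D) ≐ Des σ
  SetX-ψ-reverse (f , g) = to , from
    where
    to : ∀ {x} → SetX (ψ D) x → Des σ x
    to {x} x∈ = let i , r , ¬x , x≡ = proj₁ (ψ-SetX D) x∈ in
      subst (Des σ) (sym x≡) (Asc-reverse⇒Des σ (¬Des⇒Asc (reverse ∘ₚ σ) r (λ d → ¬x (g d))))
    from : ∀ {x} → Des σ x → SetX (ψ D) x
    from {x} d@(j , _ , x≡ , _) = proj₂ (ψ-SetX D)
      (n ∸ x , Asc-range (reverse ∘ₚ σ) asc
      , (λ x∈ → Asc⇒¬Des (reverse ∘ₚ σ) asc (f x∈))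
      , sym (ℕₚ.m∸[m∸n]≡n (subst (_≤ n) (sym x≡) (Finₚ.toℕ<n j))))
      where
      asc : Asc (reverse ∘ₚ σ) (n ∸ x)
      asc = Des⇒Asc-reverse σ d

  SetY-ψ-reverse : SetY D ≐ iDes (reverse ∘ₚ σ) →
    SetY (ψ D) ≐ λ y → ∃ λ u → iDes σ u × y ≡ n ∸ u
  SetY-ψ-reverse (f , g) =
    (λ y∈ → let u , r , ¬y , y≡ = proj₁ (ψ-SetY D) y∈
            in u , Asc-flip-reverse⇒iDes σ (¬Des⇒Asc (flip (reverse ∘ₚ σ)) r (λ d → ¬y (g d))) , y≡)
    , λ (u , d , y≡) → let asc = iDes⇒Asc-flip-reverse σ d in
        proj₂ (ψ-SetY D)
          (u , Asc-range (flip (reverse ∘ₚ σ)) asc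
          , (λ y∈ → Asc⇒¬Des (flip (reverse ∘ₚ σ)) asc (f y∈)) , y≡)

-- Valleys of the paths read by κ

module _ (a : ℕ) {c h : ℕ} (hs : List ℕ) where

  -- After an east step ending at the point (a , a + c), the next entry is
  -- read either with at least one north step, which makes that point a
  -- valley, or with none.
  read-valley : c ≤ h → valleysE a (a + c) (κ-read c (h ∷ hs)) ≡
    (a , a + c) ∷ valleysE (suc a) (suc a + h) (κ-read h hs)
  read-valley c≤h rewrite ℕₚ.+-∸-assoc 1 c≤h = cong ((a , a + c) ∷_)
    (trans (valleysN-norths (h ∸ c) a (suc (a + c)) (east ∷ κ-read h hs))
      (cong (λ b → valleysE (suc a) b (κ-read h hs)) height))
    where
    open ≡-Reasoning
    height : (h ∸ c) + suc (a + c) ≡ suc a + h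
    height = begin
      (h ∸ c) + suc (a + c)   ≡⟨ ℕₚ.+-comm (h ∸ c) _ ⟩
      suc a + c + (h ∸ c)     ≡⟨ ℕₚ.+-assoc (suc a) c _ ⟩
      suc a + (c + (h ∸ c))   ≡⟨ cong (suc a +_) (ℕₚ.m+[n∸m]≡n c≤h) ⟩
      suc a + h               ∎

  read-no-valley : c ≡ suc h → valleysE a (a + c) (κ-read c (h ∷ hs)) ≡
    valleysE (suc a) (suc a + h) (κ-read h hs)
  read-no-valley refl rewrite ℕₚ.n∸n≡0 h =
    cong (λ b → valleysE (suc a) b (κ-read h hs)) (ℕₚ.+-suc a h)

-- For the sequence f of the numbers hᵢ, indexed from 0, the valleys lie at
-- the weak rises of f; the offset a is the x-coordinate reached after
-- reading the first entry.
RiseAt : ∀ {m} → ℕ → (Fin m → ℕ) → Pred (ℕ × ℕ) 0ℓ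
RiseAt {m} a f p = ∃₂ λ (i j : Fin m) →
  toℕ j ≡ suc (toℕ i) × f i ≤ f j × p ≡ (a + toℕ i , a + toℕ i + f i)

-- The sequence never drops by more than 1, as holds for the numbers hᵢ of a
-- permutation that avoids 132.  Since reading an entry adjoins a single east
-- step, a larger drop could not be read.
SlowDescent : ∀ {m} → (Fin m → ℕ) → Set
SlowDescent {m} f = ∀ (i j : Fin m) → toℕ j ≡ suc (toℕ i) → f i ≤ suc (f j)

RiseAt-suc : ∀ {m a} {f : Fin (suc m) → ℕ} {p} → RiseAt (suc a) (f ∘ suc) p → RiseAt a f p
RiseAt-suc {a = a} {f} (i , j , j≡ , le , refl) = suc i , suc j , cong suc j≡ , le ,
  cong (λ x → x , x + f (suc i)) (sym (ℕₚ.+-suc a (toℕ i)))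

-- The valleys met after the first entry of f has been read.
valleysAfter : ∀ {m} → ℕ → (Fin (suc m) → ℕ) → List (ℕ × ℕ)
valleysAfter a f = valleysE a (a + f zero) (κ-read (f zero) (tabulate (λ i → f (suc i))))

module _ {m : ℕ} (a : ℕ) (f : Fin (suc (suc m)) → ℕ) where

  private
    rest : List ℕ
    rest = tabulate (λ i → f (suc (suc i)))

  valleysAfter-rise : f zero ≤ f (suc zero) →
    valleysAfter a f ≡ (a , a + f zero) ∷ valleysAfter (suc a) (f ∘ suc)
  valleysAfter-rise = read-valley a rest

  valleysAfter-fall : SlowDescent f → ¬ f zero ≤ f (suc zero) →
    valleysAfter a f ≡ valleysAfter (suc a) (f ∘ suc)
  valleysAfter-fall slow ≰ =
    read-no-valley a rest (ℕₚ.≤-antisym (slow zero (suc zero) refl) (ℕₚ.≰⇒> ≰))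

  valleysAfter-suc : SlowDescent f → ∀ {p} →
    p ∈ valleysAfter (suc a) (f ∘ suc) → p ∈ valleysAfter a f
  valleysAfter-suc slow {p} p∈ with f zero ℕₚ.≤? f (suc zero)
  ... | yes le = subst (p ∈_) (sym (valleysAfter-rise le)) (there p∈)
  ... | no ≰ = subst (p ∈_) (sym (valleysAfter-fall slow ≰)) p∈

SlowDescent-suc : ∀ {m} {f : Fin (suc m) → ℕ} → SlowDescent f → SlowDescent (f ∘ suc)
SlowDescent-suc slow i j eq = slow (suc i) (suc j) (cong suc eq)

valleysAfter-sound : ∀ m a (f : Fin (suc m) → ℕ) → SlowDescent f → ∀ {p} →
  p ∈ valleysAfter a f → RiseAt a f p
valleysAfter-sound (suc m) a f slow {p} p∈ with f zero ℕₚ.≤? f (suc zero)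
... | no ≰ = RiseAt-suc (valleysAfter-sound m (suc a) (f ∘ suc) (SlowDescent-suc slow)
          (subst (p ∈_) (valleysAfter-fall a f slow ≰) p∈))
... | yes le with subst (p ∈_) (valleysAfter-rise a f le) p∈
...   | here refl = zero , suc zero , refl , le ,
          cong (λ x → x , x + f zero) (sym (ℕₚ.+-identityʳ a))
...   | there p∈' = RiseAt-suc (valleysAfter-sound m (suc a) (f ∘ suc) (SlowDescent-suc slow) p∈')

valleysAfter-complete : ∀ m a (f : Fin (suc m) → ℕ) → SlowDescent f → ∀ {p} →
  RiseAt a f p → p ∈ valleysAfter a f
valleysAfter-complete zero a f slow (zero , zero , () , _)
valleysAfter-complete (suc m) a f slow {p} (zero , suc zero , j≡ , le , p≡) =
  subst (p ∈_) (sym (valleysAfter-rise a f le))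
    (here (trans p≡ (cong (λ x → x , x + f zero) (ℕₚ.+-identityʳ a))))
valleysAfter-complete (suc m) a f slow (suc i , suc j , j≡ , le , p≡) = valleysAfter-suc a f slow
  (valleysAfter-complete m (suc a) (f ∘ suc) (SlowDescent-suc slow)
    (i , j , ℕₚ.suc-injective j≡ , le ,
     trans p≡ (cong (λ x → x , x + f (suc i)) (ℕₚ.+-suc a (toℕ i)))))

Valleys-κ : ∀ {m} (σ : S132 (suc m)) → Valleys (κ σ) ≐ RiseAt 1 (κ-height (proj₁ σ))
Valleys-κ {m} σ@(s , av) =
  (λ val → valleysAfter-sound m 1 h slow (subst (_ ∈_) first (proj₁ (Valleys⇔valleys (κ σ)) val)))
  , λ rise → proj₂ (Valleys⇔valleys (κ σ)) (subst (_ ∈_) (sym first) (valleysAfter-complete m 1 h slow rise))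
  where
  h = κ-height s
  slow : SlowDescent h
  slow = κ-height-step s av
  first : valleysN 0 0 (κ-word s) ≡ valleysAfter 1 h
  first = trans (valleysN-norths (suc (h zero)) 0 0 (east ∷ κ-read (h zero) (tabulate (h ∘ suc))))
    (cong (λ b → valleysE 1 b (κ-read (h zero) (tabulate (h ∘ suc)))) (ℕₚ.+-identityʳ (suc (h zero))))

-- Counting

count-split : ∀ {A : Set} {P Q R : Pred A 0ℓ}
  (P? : Decidable P) (Q? : Decidable Q) (R? : Decidable R) →
  (∀ {x} → P x → ¬ Q x) → (∀ {x} → P x → R x) → (∀ {x} → Q x → R x) →
  (∀ {x} → R x → P x ⊎ Q x) → ∀ xs →
  length (filter P? xs) + length (filter Q? xs) ≡ length (filter R? xs)
count-split P? Q? R? disjoint P⇒R Q⇒R cover = go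
  where
  go : ∀ xs → length (filter P? xs) + length (filter Q? xs) ≡ length (filter R? xs)
  go [] = refl
  go (x ∷ xs) with P? x | Q? x | R? x
  ... | yes p | yes q | _ = contradiction q (disjoint p)
  ... | yes p | no _ | yes _ = cong suc (go xs)
  ... | no _ | yes q | yes _ = trans (ℕₚ.+-suc _ _) (cong suc (go xs))
  ... | no _ | no _ | no _ = go xs
  ... | yes p | no _ | no ¬r = contradiction (P⇒R p) ¬r
  ... | no _ | yes q | no ¬r = contradiction (Q⇒R q) ¬r
  ... | no ¬p | no ¬q | yes r with cover r
  ...   | inj₁ p = contradiction p ¬p
  ...   | inj₂ q = contradiction q ¬q

module _ {n : ℕ} (σ : Permutation′ n) where

  -- Entries are numbered from 0 here, so m of them are below m.
  entry<? : ∀ m → Decidable (λ (j : Fin n) → toℕ (σ ⟨$⟩ʳ j) < m)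
  entry<? m j = toℕ (σ ⟨$⟩ʳ j) ℕₚ.<? m

  count-entry< : ∀ {m} → m ≤ n → length (filter (entry<? m) (allFin n)) ≡ m
  count-entry< {m} m≤n = ℕₚ.≤-antisym
    (subst (length (filter (entry<? m) (allFin n)) ≤_) (Listₚ.length-upTo m)
      (length-≤ Entry (Uniqueₚ.filter⁺ (entry<? m) (Uniqueₚ.allFin⁺ n)) (upTo m)
        (λ eq eq' → val-injective σ (Finₚ.toℕ-injective (trans eq (sym eq'))))
        (λ j∈ → _ , ∈ₚ.∈-upTo⁺ (proj₂ (∈ₚ.∈-filter⁻ (entry<? m) {xs = allFin n} j∈)) , refl)))
    (subst (_≤ length (filter (entry<? m) (allFin n))) (Listₚ.length-upTo m)
      (length-≤ (λ v j → Entry j v) (Uniqueₚ.upTo⁺ m) (filter (entry<? m) (allFin n))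
        (λ eq eq' → trans (sym eq) eq')
        (λ v∈ → position (∈ₚ.∈-upTo⁻ v∈))))
    where
    Entry : Fin n → ℕ → Set
    Entry j v = toℕ (σ ⟨$⟩ʳ j) ≡ v
    position : ∀ {v} → v < m → ∃ λ j → j ∈ filter (entry<? m) (allFin n) × Entry j v
    position {v} v<m = σ ⟨$⟩ˡ w
      , ∈ₚ.∈-filter⁺ (entry<? m) (∈ₚ.∈-allFin _) (subst (_< m) (sym entry) v<m) , entry
      where
      w : Fin n
      w = fromℕ< (ℕₚ.<-≤-trans v<m m≤n)
      entry : toℕ (σ ⟨$⟩ʳ (σ ⟨$⟩ˡ w)) ≡ v
      entry = trans (cong toℕ (inverseʳ σ)) (Finₚ.toℕ-fromℕ< _)

-- Heights of κ and inverse descents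

least-satisfying : ∀ {n} {P : Pred (Fin n) 0ℓ} → Decidable P → ∀ x → P x →
  ∃ λ w → P w × (∀ v → v Fin.< w → ¬ P v)
least-satisfying {n} {P} P? x px =
  let w , ¬¬pw , before = Finₚ.¬∀⟶∃¬-smallest n (¬_ ∘ P) (¬? ∘ P?) (λ none → none x px)
  in w , decidable-stable (P? w) ¬¬pw , λ v v<w → subst (¬_ ∘ P)
       (Finₚ.toℕ-injective (trans (Finₚ.toℕ-inject (fromℕ< v<w)) (Finₚ.toℕ-fromℕ< v<w)))
       (before (fromℕ< v<w))

module _ {n : ℕ} (σ : Permutation′ n) where

  private
    val pos : Fin n → Fin n
    val = σ ⟨$⟩ʳ_
    pos = σ ⟨$⟩ˡ_

  κ-height-≤ : ∀ i ks → (∀ l → i Fin.< l → val i Fin.< val l → l ∈ ks) → κ-height σ i ≤ length ks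
  κ-height-≤ i ks incl = length-≤ _≡_ (Uniqueₚ.filter⁺ (larger-right? σ i) (Uniqueₚ.allFin⁺ n)) ks
    (λ p q → trans p (sym q))
    (λ {l} l∈ → let i<l , lt = proj₂ (∈ₚ.∈-filter⁻ (larger-right? σ i) {xs = allFin n} l∈)
                in l , incl l i<l lt , refl)

  private
    ∈-larger-right : ∀ {i l} → i Fin.< l → val i Fin.< val l →
      l ∈ filter (larger-right? σ i) (allFin n)
    ∈-larger-right {i} {l} i<l lt = ∈ₚ.∈-filter⁺ (larger-right? σ i) (∈ₚ.∈-allFin l) (i<l , lt)

  Des-κ-height : ∀ {i j} → toℕ j ≡ suc (toℕ i) → val j Fin.< val i → κ-height σ i ≤ κ-height σ j
  Des-κ-height {i} {j} j≡ gt = κ-height-≤ i _ λ l i<l lt →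
    ∈-larger-right
      (Finₚ.≤∧≢⇒< (subst (_≤ toℕ l) (sym j≡) i<l) (λ { refl → ℕₚ.<-asym gt lt }))
      (ℕₚ.<-trans gt lt)

  κ-height-Des : ∀ {i j} → toℕ j ≡ suc (toℕ i) → κ-height σ i ≤ κ-height σ j → val j Fin.< val i
  κ-height-Des {i} {j} j≡ le with Finₚ.<-cmp (val j) (val i)
  ... | tri< gt _ _ = gt
  ... | tri≈ _ eq _ = contradiction (trans (sym j≡) (cong toℕ (val-injective σ eq))) ℕₚ.1+n≢n
  ... | tri> _ _ lt = contradiction le (ℕₚ.<⇒≱ more)
    where
    i<j : i Fin.< j
    i<j = ℕₚ.≤-reflexive (sym j≡)
    -- The larger entries right of j, and that at j itself, are counted at i.
    more : κ-height σ j < κ-height σ i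
    more = length-≤ _≡_
      (Allₚ.¬Any⇒All¬ _ (λ j∈ → ℕₚ.<-irrefl refl
        (proj₁ (proj₂ (∈ₚ.∈-filter⁻ (larger-right? σ j) {xs = allFin n} j∈))))
        AllPairs.∷ Uniqueₚ.filter⁺ (larger-right? σ j) (Uniqueₚ.allFin⁺ n))
      (filter (larger-right? σ i) (allFin n)) (λ p q → trans p (sym q)) λ where
        (here refl) → j , ∈-larger-right i<j lt , refl
        {l} (there l∈) →
          let j<l , lt' = proj₂ (∈ₚ.∈-filter⁻ (larger-right? σ j) {xs = allFin n} l∈)
          in l , ∈-larger-right (ℕₚ.<-trans i<j j<l) (ℕₚ.<-trans lt lt') , refl

  -- The smaller entries to the right of position i are exactly the u
  -- smallest entries of σ, which are those below u when values are numbered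
  -- from 0.
  Cut : Fin n → ℕ → Set
  Cut i u = (∀ j → toℕ (val j) < u → i Fin.< j × val j Fin.< val i) ×
    (∀ j → i Fin.< j → val j Fin.< val i → toℕ (val j) < u)

  -- The n - u entries outside the cut are those up to position i and the
  -- larger ones after it.
  κ-height-Cut : ∀ {i u} → u ≤ n → Cut i u → suc (toℕ i) + κ-height σ i ≡ n ∸ u
  κ-height-Cut {i} {u} u≤n (small , cut) = begin
    suc (toℕ i) + κ-height σ i
      ≡⟨ cong (_+ κ-height σ i) (count-entry< idₚ (Finₚ.toℕ<n i)) ⟨
    length (filter (entry<? idₚ (suc (toℕ i))) (allFin n)) + κ-height σ i
      ≡⟨ count-split (entry<? idₚ (suc (toℕ i))) (larger-right? σ i) large?
           (λ { (s≤s j≤i) (i<j , _) → ℕₚ.<⇒≱ i<j j≤i })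
           (λ { {j} (s≤s j≤i) vj<u → ℕₚ.<⇒≱ (proj₁ (small j vj<u)) j≤i })
           (λ { {j} (_ , lt) vj<u → ℕₚ.<-asym lt (proj₂ (small j vj<u)) })
           cover (allFin n) ⟩
    length (filter large? (allFin n))
      ≡⟨ ℕₚ.m+n∸m≡n u _ ⟨
    u + length (filter large? (allFin n)) ∸ u
      ≡⟨ cong (λ k → k + length (filter large? (allFin n)) ∸ u) (count-entry< σ u≤n) ⟨
    length (filter (entry<? σ u) (allFin n)) + length (filter large? (allFin n)) ∸ u
      ≡⟨ cong (_∸ u) (trans
           (count-split (entry<? σ u) large? (entry<? σ n) (λ lt ≮ → ≮ lt)
             (λ _ → Finₚ.toℕ<n _) (λ _ → Finₚ.toℕ<n _) (λ {j} _ → toSum (entry<? σ u j)) (allFin n))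
           (count-entry< σ ℕₚ.≤-refl)) ⟩
    n ∸ u ∎
    where
    open ≡-Reasoning
    large? : Decidable (λ (j : Fin n) → ¬ toℕ (val j) < u)
    large? = ∁? (entry<? σ u)
    cover : ∀ {j} → ¬ toℕ (val j) < u →
      toℕ j < suc (toℕ i) ⊎ (i Fin.< j × val i Fin.< val j)
    cover {j} ≮ with toℕ j ℕₚ.≤? toℕ i
    ... | yes j≤i = inj₁ (s≤s j≤i)
    ... | no ≰ = let i<j = ℕₚ.≰⇒> ≰ in inj₂ (i<j , Finₚ.≤∧≢⇒<
          (ℕₚ.≮⇒≥ (λ lt → ≮ (cut j i<j lt)))
          (λ eq → ℕₚ.<-irrefl (cong toℕ (val-injective σ eq)) i<j))

  module _ (av : Avoids132 σ) where

    -- If σᵢ is followed by a smaller entry σⱼ, no value w found at or left of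
    -- position i is below σⱼ: otherwise w, σᵢ, σⱼ would form a 132.
    left-not-below : ∀ {i j} w → i Fin.< j → toℕ (pos w) ≤ toℕ i → val j Fin.< val i →
      ¬ w Fin.< val j
    left-not-below {i} {j} w i<j pw≤i gt w<vj with Finₚ.<-cmp (pos w) i
    ... | tri< pw<i _ _ = av (pos w) i j pw<i i<j
            (subst (Fin._< val j) (sym (inverseʳ σ)) w<vj , gt)
    ... | tri≈ _ eq _ = ℕₚ.<-asym w<vj
            (subst (val j Fin.<_) (trans (cong val (sym eq)) (inverseʳ σ)) gt)
    ... | tri> _ _ i<pw = ℕₚ.<⇒≱ i<pw pw≤i

    Des⇒Cut : ∀ {i k} → toℕ k ≡ suc (toℕ i) → val k Fin.< val i →
      ∃ λ u → iDes σ u × Cut i u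
    Des⇒Cut {i} {k} k≡ gt = toℕ w , ides , small , cut
      where
      Smaller-right : Fin n → Set
      Smaller-right v = i Fin.< pos v × v Fin.< val i
      Smaller-right? : Decidable Smaller-right
      Smaller-right? v = (i Finₚ.<? pos v) ×-dec (v Finₚ.<? val i)
      -- σᵢ itself is not a smaller entry to its right, so there is a least
      -- such value w.
      least : ∃ λ w → ¬ Smaller-right w × (∀ v → v Fin.< w → ¬ ¬ Smaller-right v)
      least = least-satisfying (¬? ∘ Smaller-right?) (val i) (ℕₚ.<-irrefl refl ∘ proj₂)
      w : Fin n
      w = proj₁ least
      ¬w : ¬ Smaller-right w
      ¬w = proj₁ (proj₂ least)
      below : ∀ v → v Fin.< w → Smaller-right v
      below v v<w = decidable-stable (Smaller-right? v) (proj₂ (proj₂ least) v v<w)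

      small : ∀ j → toℕ (val j) < toℕ w → i Fin.< j × val j Fin.< val i
      small j vj<w = let i<p , lt = below (val j) vj<w
                     in subst (i Fin.<_) (inverseˡ σ) i<p , lt

      w≤vi : toℕ w ≤ toℕ (val i)
      w≤vi = ℕₚ.≮⇒≥ λ vi<w → ℕₚ.<-irrefl refl (proj₂ (below (val i) vi<w))

      pw≤i : toℕ (pos w) ≤ toℕ i
      pw≤i = ℕₚ.≮⇒≥ λ i<pw → ¬w (i<pw , Finₚ.≤∧≢⇒< w≤vi λ w≡vi →
        ℕₚ.<-irrefl (cong toℕ (sym (trans (cong pos w≡vi) (inverseˡ σ)))) i<pw)

      cut : ∀ j → i Fin.< j → val j Fin.< val i → toℕ (val j) < toℕ w
      cut j i<j lt with Finₚ.<-cmp (val j) w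
      ... | tri< vj<w _ _ = vj<w
      ... | tri≈ _ eq _ = contradiction (subst Smaller-right eq
              (subst (i Fin.<_) (sym (inverseˡ σ)) i<j , lt)) ¬w
      ... | tri> _ _ w<vj = contradiction w<vj (left-not-below w i<j pw≤i lt)

      ides : iDes σ (toℕ w)
      -- The value w is not the smallest, since the entry at k is below it.
      ides with toℕ w in eq | cut k (ℕₚ.≤-reflexive (sym k≡)) gt
      ... | suc p | _ = fromℕ< p<n , w , cong suc (sym p≡) , trans eq (cong suc (sym p≡)) ,
            ℕₚ.≤-<-trans pw≤i (proj₁ (below (fromℕ< p<n)
              (subst₂ _<_ (sym p≡) (sym eq) (ℕₚ.n<1+n p))))
        where
        p<n : p < n
        p<n = ℕₚ.<⇒≤ (subst (_< n) eq (Finₚ.toℕ<n w))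
        p≡ : toℕ (fromℕ< p<n) ≡ p
        p≡ = Finₚ.toℕ-fromℕ< p<n

    iDes⇒Cut : ∀ {u} → iDes σ u →
      ∃₂ λ i k → toℕ k ≡ suc (toℕ i) × val k Fin.< val i × Cut i u
    iDes⇒Cut {u} (v , w , u≡ , w≡ , pw<pv) = result
      where
      -- Numbered from 0, the values u - 1 and u are v and w.
      w≡u : toℕ w ≡ u
      w≡u = trans w≡ (sym u≡)

      -- q is the leftmost position of an entry below w.
      least : ∃ λ q → val q Fin.< w × (∀ r → r Fin.< q → ¬ val r Fin.< w)
      least = least-satisfying (λ r → val r Finₚ.<? w) (pos v)
        (subst (Fin._< w) (sym (inverseʳ σ)) (ℕₚ.≤-reflexive (sym w≡)))
      q : Fin n
      q = proj₁ least
      vq<w : val q Fin.< w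
      vq<w = proj₁ (proj₂ least)
      before-q : ∀ r → r Fin.< q → ¬ val r Fin.< w
      before-q = proj₂ (proj₂ least)

      -- All entries below w lie to its right: v does, and a smaller entry to
      -- the left would form a 132 with w and v.
      pw<q : pos w Fin.< q
      pw<q = ℕₚ.≰⇒> left-of-w
        where
        left-of-w : ¬ toℕ q ≤ toℕ (pos w)
        left-of-w q≤pw with Finₚ.<-cmp (val q) v
        ... | tri> _ _ v<vq = ℕₚ.<⇒≱ vq<w (subst (_≤ toℕ (val q)) (sym w≡) v<vq)
        ... | tri≈ _ vq≡v _ = ℕₚ.<⇒≱ pw<pv
                (subst (_≤ toℕ (pos w)) (cong toℕ (trans (sym (inverseˡ σ)) (cong pos vq≡v))) q≤pw)
        ... | tri< vq<v _ _ = left-not-below (val q) pw<pv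
                (subst (_≤ toℕ (pos w)) (cong toℕ (sym (inverseˡ σ))) q≤pw)
                (subst₂ Fin._<_ (sym (inverseʳ σ)) (sym (inverseʳ σ)) (ℕₚ.≤-reflexive (sym w≡)))
                (subst (val q Fin.<_) (sym (inverseʳ σ)) vq<v)

      result : ∃₂ λ i k → toℕ k ≡ suc (toℕ i) × val k Fin.< val i × Cut i u
      -- Position q has a predecessor i, since it is right of w; the entry at
      -- i is not below w, by the choice of q.
      result with toℕ q in q≡ | pw<q
      ... | suc p | s≤s pw≤p = i , q , trans q≡ (cong suc (sym i≡)) , ℕₚ.<-≤-trans vq<w w≤vi
          , small , cut
        where
        p<n : p < n
        p<n = ℕₚ.<⇒≤ (subst (_< n) q≡ (Finₚ.toℕ<n q))
        i : Fin n
        i = fromℕ< p<n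
        i≡ : toℕ i ≡ p
        i≡ = Finₚ.toℕ-fromℕ< p<n
        w≤vi : toℕ w ≤ toℕ (val i)
        w≤vi = ℕₚ.≮⇒≥ (before-q i (subst₂ _<_ (sym i≡) (sym q≡) (ℕₚ.n<1+n p)))
        small : ∀ j → toℕ (val j) < u → i Fin.< j × val j Fin.< val i
        small j vj<u =
          subst₂ _≤_ (trans q≡ (cong suc (sym i≡))) refl
            (ℕₚ.≮⇒≥ λ j<q → before-q j j<q vj<w) , ℕₚ.<-≤-trans vj<w w≤vi
          where
          vj<w : val j Fin.< w
          vj<w = subst (toℕ (val j) <_) (sym w≡u) vj<u
        cut : ∀ j → i Fin.< j → val j Fin.< val i → toℕ (val j) < u
        cut j i<j lt = subst (toℕ (val j) <_) w≡u (Finₚ.≤∧≢⇒<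
          (ℕₚ.≮⇒≥ (left-not-below w i<j (subst (toℕ (pos w) ≤_) (sym i≡) pw≤p) lt))
          (λ vj≡w → ℕₚ.<⇒≱ i<j (subst₂ _≤_
            (cong toℕ (trans (cong pos (sym vj≡w)) (inverseˡ σ))) (sym i≡) pw≤p)))

  iDes-≤ : ∀ {u} → iDes σ u → u ≤ n
  iDes-≤ (v , _ , u≡ , _) = subst (_≤ n) (sym u≡) (Finₚ.toℕ<n v)

module _ {m : ℕ} (σ : Permutation′ (suc m)) (av : Avoids132 σ) where

  SetX-κ : SetX (κ (σ , av)) ≐ Des σ
  SetX-κ = to , from
    where
    to : ∀ {x} → SetX (κ (σ , av)) x → Des σ x
    to (y , val) = let i , j , j≡ , le , p≡ = proj₁ (Valleys-κ (σ , av)) val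
                   in i , j , cong proj₁ p≡ , j≡ , κ-height-Des σ j≡ le
    from : ∀ {x} → Des σ x → SetX (κ (σ , av)) x
    from (i , j , refl , j≡ , gt) =
      _ , proj₂ (Valleys-κ (σ , av)) (i , j , j≡ , Des-κ-height σ j≡ gt , refl)

  SetY-κ : SetY (κ (σ , av)) ≐ λ y → ∃ λ u → iDes σ u × y ≡ suc m ∸ u
  SetY-κ = to , from
    where
    to : ∀ {y} → SetY (κ (σ , av)) y → ∃ λ u → iDes σ u × y ≡ suc m ∸ u
    to (x , val) =
      let i , j , j≡ , le , p≡ = proj₁ (Valleys-κ (σ , av)) val
          u , ides , c = Des⇒Cut σ av j≡ (κ-height-Des σ j≡ le)
      in u , ides , trans (cong proj₂ p≡) (κ-height-Cut σ (iDes-≤ σ ides) c)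
    from : ∀ {y} → (∃ λ u → iDes σ u × y ≡ suc m ∸ u) → SetY (κ (σ , av)) y
    from (u , ides , y≡) =
      let i , j , j≡ , gt , c = iDes⇒Cut σ av ides
      in suc (toℕ i) , proj₂ (Valleys-κ (σ , av)) (i , j , j≡ , Des-κ-height σ j≡ gt ,
           cong (suc (toℕ i) ,_) (trans y≡ (sym (κ-height-Cut σ (iDes-≤ σ ides) c))))

theorem5p6 : ∀ (n : ℕ) → 1 ≤ n → ∀ (σ : S132 n) → κ σ ≈ ψ (Φ (ρ σ))
theorem5p6 (suc m) _ (σ , av) = ≈-from-sets (κ (σ , av)) (ψ D)
  (≐-via (SetX-κ σ av) (SetX-ψ-reverse σ D (SetX-Φ (reverse ∘ₚ σ) (reverse-avoids σ av))))
  (≐-via (SetY-κ σ av) (SetY-ψ-reverse σ D (SetY-Φ (reverse ∘ₚ σ) (reverse-avoids σ av))))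
  where
  D : Dyck (suc m)
  D = Φ (ρ (σ , av))
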